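{- The following parameterized problem, called Small-Clique-Extension, is in $\forall^{*}\exists^{k}\text{ -W}[1]$: given a graph $G=(V,E)$, a subset $V'\subseteq V$, and an integer $k$, with parameter $k$, decide whether it is the case that for each clique $C\subseteq V'$ there is some $k$-clique $D$ of $G$ such that $C\cup D$ is a $(|C|+k)$-clique.
   Context: A parameterized problem is a subset $L \subseteq \Sigma^{*} \times \mathbb{N}$ for a finite alphabet $\Sigma$; in an instance $(I,k)$, $k$ is the parameter. An fpt-reduction from $L$ to $L'$ is a mapping $R$ from instances to instances for which there is a computable function $g$ such that for all $(I,k)$, with $(I',k')=R(I,k)$: $(I,k)\in L$ iff $(I',k')\in L'$; $k'\leq g(k)$; and $R$ is computable in time $O(f(k)|I|^{c})$ for some computable $f$ and constant $c$. A clique of $G=(V,E)$ is a subset $C\subseteq V$ with $\{v,v'\}\in E$ for all distinct $v,v'\in C$; an $\ell$-clique is a clique with exactly $\ell$ vertices. Boolean circuits have a single output gate; their input nodes are called variables. Gates of fan-in $>2$ are large. The depth of a circuit is the length of a longest path from any variable to the output gate; the weft is the largest number of large gates on any path from a variable to the output gate. $\Gamma_{t,u}$ is the class of Boolean circuits of depth at most $u$ and weft at most $t$. The weight of a truth assignment is the number of variables it sets to true. For a class $\mathcal{C}$ of circuits, $\exists^{*}\forall^{k}\text{ -WSat}(\mathcal{C})$ is the problem: given a circuit in $\mathcal{C}$ over two disjoint sets $X$ and $Y$ of variables and an integer $k$ (the parameter), does there exist a truth assignment $\alpha$ to $X$ such that for all truth assignments $\beta$ to $Y$ of weight $k$ the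 assignment $\alpha\cup\beta$ satisfies the circuit? The class $\exists^{*}\forall^{k}\text{ -W}[1]$ consists of all parameterized problems fpt-reducible to $\exists^{*}\forall^{k}\text{ -WSat}(\Gamma_{1,u})$ for some $u\geq 1$. The class $\forall^{*}\exists^{k}\text{ -W}[1]$ is its co-class; equivalently, it consists of all parameterized problems fpt-reducible, for some $u\geq1$, to the problem $\forall^{*}\exists^{k}\text{ -WSat}(\Gamma_{1,u})$, which asks whether for all truth assignments to $X$ there exists a truth assignment to $Y$ of weight $k$ such that together they satisfy the circuit. -}

module Defs where

open import Data.Bool.Base using (Bool; true; false; not; if_then_else_)
open import Data.Bool.ListAction using (all; any)
open import Data.Fin.Base using (Fin; zero; suc; toℕ; inject)
open import Data.Fin.Patterns
open import Data.Fin.Subset using (Subset; _∈_; _⊆_; _∪_; ∣_∣)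
open import Data.List.Base
  using (List; []; _∷_; _++_; map; concatMap; replicate; length; allFin)
open import Data.List.NonEmpty.Base as List⁺ using (List⁺)
import Data.List.Membership.Propositional as List
open import Data.Maybe.Base using (Maybe; just; nothing)
open import Data.Nat.Base using (ℕ; zero; suc; _+_; _*_; _^_; _≤_; _<ᵇ_)
open import Data.Product.Base using (∃; ∃-syntax; _×_; _,_)
open import Data.Sum.Base using (_⊎_; inj₁; inj₂)
open import Data.Vec.Base as Vec using (Vec; []; _∷_; lookup; _[_]≔_)
open import Function.Bundles using (_⇔_)
open import Relation.Binary.PropositionalEquality using (_≡_; _≢_)
open import Relation.Nullary.Negation using (¬_)

------------------------------------------------------------------------
-- Computation

-- The machine model is that of multi-tape Turing machines presented as
-- structured programs over t stacks.  A is instantiated with finite alphabets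
-- only, so the branching in `pop` is a finite case distinction.

data Program (A : Set) (t : ℕ) : Set where
  skip  : Program A t
  push  : Fin t → A → Program A t
  pop   : Fin t → (Maybe A → Program A t) → Program A t
  _⨾_   : Program A t → Program A t → Program A t
  while : Fin t → Program A t → Program A t

Store : Set → ℕ → Set
Store A t = Vec (List A) t

-- Run P σ n τ: started on σ, the program P halts after n steps in τ.
-- `pop x c` removes the top symbol of x, if there is one, and continues
-- accordingly; `while x P` repeats P as long as x is nonempty.

data Run {A : Set} {t : ℕ} :
         Program A t → Store A t → ℕ → Store A t → Set where
  skip   : ∀ {σ} → Run skip σ 1 σ
  push   : ∀ {σ x a} → Run (push x a) σ 1 (σ [ x ]≔ (a ∷ lookup σ x))
  pop-[] : ∀ {σ τ x c n} → lookup σ x ≡ [] →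
           Run (c nothing) σ n τ → Run (pop x c) σ (suc n) τ
  pop-∷  : ∀ {σ τ x c n a as} → lookup σ x ≡ a ∷ as →
           Run (c (just a)) (σ [ x ]≔ as) n τ → Run (pop x c) σ (suc n) τ
  _⨾_    : ∀ {σ ρ τ P Q m n} →
           Run P σ m ρ → Run Q ρ n τ → Run (P ⨾ Q) σ (m + n) τ
  stop   : ∀ {σ x P} → lookup σ x ≡ [] → Run (while x P) σ 1 σ
  loop   : ∀ {σ ρ τ x P m n a as} → lookup σ x ≡ a ∷ as →
           Run P σ m ρ → Run (while x P) ρ n τ →
           Run (while x P) σ (suc (m + n)) τ

-- Numbers are given in unary, with the symbol zero as tally mark.

Computable : (ℕ → ℕ) → Set
Computable f =
  ∃[ e ] ∃[ w ] ∃ λ (P : Program (Fin (suc e)) (suc w)) →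
  ∀ n → ∃[ steps ] ∃[ rest ]
    Run P (replicate n zero ∷ Vec.replicate w []) steps
          (replicate (f n) zero ∷ rest)

------------------------------------------------------------------------
-- Parameterized problems and fpt-reductions

record Problem : Set₁ where
  field
    alphabet : ℕ  -- the number of symbols
    Yes      : List (Fin alphabet) → ℕ → Set

  String : Set
  String = List (Fin alphabet)

co : Problem → Problem
co L = record { alphabet = alphabet ; Yes = λ I k → ¬ Yes I k }
  where open Problem L

record FptReduction (L L′ : Problem) : Set where
  open Problem L  using () renaming (String to String₁; Yes to Yes₁; alphabet to s₁)
  open Problem L′ using () renaming (String to String₂; Yes to Yes₂; alphabet to s₂)

  field
    instanceOf  : String₁ → ℕ → String₂
    parameterOf : String₁ → ℕ → ℕ

    correct : ∀ I k → Yes₁ I k ⇔ Yes₂ (instanceOf I k) (parameterOf I k)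

    g            : ℕ → ℕ
    g-computable : Computable g
    g-bound      : ∀ I k → parameterOf I k ≤ g k

    extraSymbols extraStacks : ℕ

  -- Input symbols, output symbols, and work symbols including a tally mark.
  Work : Set
  Work = Fin s₁ ⊎ Fin s₂ ⊎ Fin (suc extraSymbols)

  tally : ℕ → List Work
  tally k = replicate k (inj₂ (inj₂ zero))

  field
    program      : Program Work (2 + extraStacks)
    f            : ℕ → ℕ
    f-computable : Computable f
    c            : ℕ

    -- "Time O(f(k) |I|^c)" is read as: at most const · f(k) · |I|^c steps for
    -- all k and all I with |I| ≥ size₀; the program halts on every input.
    const size₀ : ℕ
    computes : ∀ I k → ∃[ steps ] ∃[ rest ]
      Run program
          (map inj₁ I ∷ tally k ∷ Vec.replicate extraStacks [])
          steps
          (map (λ a → inj₂ (inj₁ a)) (instanceOf I k)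
             ∷ tally (parameterOf I k) ∷ rest)
      × (size₀ ≤ length I → steps ≤ const * (f k * length I ^ c))

------------------------------------------------------------------------
-- Circuits

-- A wire leaves a variable (in X or in Y) or one of m gates.  Gates are listed
-- in reverse topological order: `gate 0F` is the latest of the m gates.

data Wire (p q m : ℕ) : Set where
  input : Fin p ⊎ Fin q → Wire p q m
  gate  : Fin m → Wire p q m

data Gate (p q m : ℕ) : Set where
  neg  : Wire p q m → Gate p q m
  conj : List⁺ (Wire p q m) → Gate p q m
  disj : List⁺ (Wire p q m) → Gate p q m

wires : ∀ {p q m} → Gate p q m → List (Wire p q m)
wires (neg w)   = w ∷ []
wires (conj ws) = List⁺.toList ws
wires (disj ws) = List⁺.toList ws

data Gates (p q : ℕ) : ℕ → Set where
  []  : Gates p q 0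
  _∷_ : ∀ {m} → Gate p q m → Gates p q m → Gates p q (suc m)

-- |X| = p and |Y| = q; the first gate listed is the output gate.

record Circuit (p q : ℕ) : Set where
  constructor circuit
  field
    {others} : ℕ
    gates    : Gates p q (suc others)

Assignment : ℕ → Set
Assignment n = Vec Bool n

-- An assignment is identified with the set of variables it sets to true.
weight : ∀ {n} → Assignment n → ℕ
weight β = ∣ β ∣

module _ {p q : ℕ} (α : Assignment p) (β : Assignment q) where

  evalWire : ∀ {m} → Vec Bool m → Wire p q m → Bool
  evalWire v (input (inj₁ x)) = lookup α x
  evalWire v (input (inj₂ y)) = lookup β y
  evalWire v (gate i)         = lookup v i

  evalGate : ∀ {m} → Vec Bool m → Gate p q m → Bool
  evalGate v (neg w)   = not (evalWire v w)
  evalGate v (conj ws) = all (evalWire v) (List⁺.toList ws)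
  evalGate v (disj ws) = any (evalWire v) (List⁺.toList ws)

  evalGates : ∀ {m} → Gates p q m → Vec Bool m
  evalGates []       = []
  evalGates (g ∷ gs) = evalGate (evalGates gs) g ∷ evalGates gs

  eval : Circuit p q → Bool
  eval C = Vec.head (evalGates (Circuit.gates C))

large : ∀ {p q m} → Gate p q m → ℕ
large g = if 2 <ᵇ length (wires g) then 1 else 0

-- Path gs i l w: there is a path from some variable to gate i with l edges and
-- w large gates on it.

data Path {p q : ℕ} : ∀ {m} → Gates p q m → Fin m → ℕ → ℕ → Set where
  start : ∀ {m} {g : Gate p q m} {gs x} →
          input x List.∈ wires g → Path (g ∷ gs) zero 1 (large g)
  step  : ∀ {m} {g : Gate p q m} {gs i l w} →
          gate i List.∈ wires g → Path gs i l w →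
          Path (g ∷ gs) zero (suc l) (large g + w)
  older : ∀ {m} {g : Gate p q m} {gs i l w} →
          Path gs i l w → Path (g ∷ gs) (suc i) l w

CircuitClass : Set₁
CircuitClass = ∀ {p q} → Circuit p q → Set

Γ : ℕ → ℕ → CircuitClass
Γ t u C = ∀ {l w} → Path (Circuit.gates C) zero l w → l ≤ u × w ≤ t

-- Indices are written in unary.  The string starts with p times x and q times
-- y, followed by the gates (latest first), each as its connective and its
-- wires; a wire to a gate is given by the index in the sense of `Wire`.

pattern ‵x    = 0F
pattern ‵y    = 1F
pattern ‵gate = 2F
pattern ‵tick = 3F
pattern ‵neg  = 4F
pattern ‵conj = 5F
pattern ‵disj = 6F

encodeWire : ∀ {p q m} → Wire p q m → List (Fin 7)
encodeWire (input (inj₁ x)) = ‵x    ∷ replicate (toℕ x) ‵tick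
encodeWire (input (inj₂ y)) = ‵y    ∷ replicate (toℕ y) ‵tick
encodeWire (gate i)         = ‵gate ∷ replicate (toℕ i) ‵tick

connective : ∀ {p q m} → Gate p q m → Fin 7
connective (neg _)  = ‵neg
connective (conj _) = ‵conj
connective (disj _) = ‵disj

encodeGates : ∀ {p q m} → Gates p q m → List (Fin 7)
encodeGates []       = []
encodeGates (g ∷ gs) = connective g ∷ concatMap encodeWire (wires g) ++ encodeGates gs

encodeCircuit : ∀ {p q} → Circuit p q → List (Fin 7)
encodeCircuit {p} {q} C =
  replicate p ‵x ++ replicate q ‵y ++ encodeGates (Circuit.gates C)

------------------------------------------------------------------------
-- The classes ∃*∀ᵏ-W[1] and ∀*∃ᵏ-W[1]

∃*∀ᵏ-WSat : CircuitClass → Problem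
∃*∀ᵏ-WSat 𝒞 = record
  { alphabet = 7
  ; Yes      = λ I k → ∃[ p ] ∃[ q ] ∃ λ (C : Circuit p q) →
      I ≡ encodeCircuit C × 𝒞 C ×
      (∃ λ (α : Assignment p) → ∀ (β : Assignment q) →
         weight β ≡ k → eval α β C ≡ true)
  }

∃*∀ᵏ-W[1] : Problem → Set
∃*∀ᵏ-W[1] L = ∃[ u ] 1 ≤ u × FptReduction L (∃*∀ᵏ-WSat (Γ 1 u))

∀*∃ᵏ-W[1] : Problem → Set
∀*∃ᵏ-W[1] L = ∃*∀ᵏ-W[1] (co L)

------------------------------------------------------------------------
-- Small-Clique-Extension

record Graph (n : ℕ) : Set where
  field
    adjacent    : Fin n → Fin n → Bool
    symmetric   : ∀ u v → adjacent u v ≡ adjacent v u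
    irreflexive : ∀ v → adjacent v v ≡ false

open Graph

IsClique : ∀ {n} → Graph n → Subset n → Set
IsClique G C = ∀ {u v} → u ∈ C → v ∈ C → u ≢ v → adjacent G u v ≡ true

IsCliqueOfSize : ∀ {n} → Graph n → ℕ → Subset n → Set
IsCliqueOfSize G ℓ C = IsClique G C × ∣ C ∣ ≡ ℓ

-- Each vertex v contributes a symbol telling whether v ∈ V′, followed by the
-- entries of the adjacency matrix strictly to the left of the diagonal.

pattern ‵in      = 0F
pattern ‵out     = 1F
pattern ‵edge    = 2F
pattern ‵nonedge = 3F

encodeGraph : ∀ {n} → Graph n → Subset n → List (Fin 4)
encodeGraph {n} G V′ = concatMap row (allFin n)
  where
  row : Fin n → List (Fin 4)
  row v = (if lookup V′ v then ‵in else ‵out)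
        ∷ map (λ u → if adjacent G v (inject u) then ‵edge else ‵nonedge)
              (allFin (toℕ v))

SmallCliqueExtension : Problem
SmallCliqueExtension = record
  { alphabet = 4
  ; Yes      = λ I k → ∃[ n ] ∃ λ (G : Graph n) → ∃ λ (V′ : Subset n) →
      I ≡ encodeGraph G V′ ×
      (∀ C → C ⊆ V′ → IsClique G C →
         ∃ λ D → IsCliqueOfSize G k D ×
                 IsCliqueOfSize G (∣ C ∣ + k) (C ∪ D))
  }

{-# OPTIONS --safe #-}

-- The complement of the problem is reduced to a circuit over X = Y = V plus a dummy vertex 0, with
-- α encoding C and β encoding D.  Each way in which C can fail to be a clique within V′, or D to
-- extend C, amounts to two variables being true together, and each symbol of the input contributes
-- boundedly many such pairs.  The circuit says that no pair with both variables in X is true, but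
-- some pair is.  Its two disjunctions are large, yet no path meets both.  The dummies keep the
-- disjunctions nonempty: a true x₀ falsifies the circuit, and a true y₀ counts as a failure of D.
--
-- The reduction reads the lower triangle of the matrix once, with counters for the entries of the
-- current row that lie ahead and that have been passed.  Writing a pair costs time linear in the
-- length of the input, and so does each wire of the two disjunctions: the total is quadratic.

module Submission where

open import Defs hiding (_⨾_)
open import Defs using () renaming (_⨾_ to infixr 5 _⨾_)
open import Data.Bool.Base using (Bool; true; false; not; _∧_; _∨_; if_then_else_)
open import Data.Bool.ListAction using (any)
import Data.Bool.Properties as Bool
open import Data.Bool.Properties using (∨-assoc; ∨-comm; ∨-identityʳ; ∨-zeroʳ; ∧-zeroʳ; ¬-not)
open import Data.Fin.Base using (Fin; zero; suc; toℕ; inject; fromℕ<)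
open import Data.Fin.Patterns
open import Data.Fin.Properties using (toℕ-inject; toℕ-fromℕ<; toℕ-injective; toℕ<n; toℕ≤pred[n])
open import Data.Fin.Subset using (Subset; _∈_; _⊆_; _∪_; _∩_; ∣_∣; ⊥)
open import Data.Fin.Subset.Properties
open import Data.List.Base
  using (List; []; _∷_; _++_; _ʳ++_; map; foldr; foldl; length; replicate; concat; concatMap;
         tabulate; allFin)
import Data.List.Base as List
open import Data.List.NonEmpty.Base as List⁺ using (List⁺; _∷_; _⁺++_)
import Data.List.Membership.Propositional.Properties as List
open import Data.List.Properties
open import Data.List.Relation.Unary.All as All using (All; []; _∷_)
import Data.List.Relation.Unary.All.Properties as All
open import Data.List.Relation.Unary.Any as Any using (Any; here; there)
import Data.List.Relation.Unary.Any.Properties as Any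
open import Data.Maybe.Base using (maybe; just; nothing)
open import Data.Nat.Base using (ℕ; zero; suc; _+_; _∸_; _*_; _^_; _≤_; _<_; _<ᵇ_; s≤s; z≤n)
open import Data.Nat.DivMod using (_mod_; m<n⇒m%n≡m)
open import Data.Nat.Properties
open import Data.Nat.Tactic.RingSolver using (solve-∀)
open import Data.Product.Base using (Σ; ∃; ∃-syntax; _×_; _,_; proj₁; proj₂)
open import Data.Product.Properties using (,-injective; ,-injectiveʳ)
open import Data.Sum.Base as Sum using (_⊎_; inj₁; inj₂; [_,_]′)
open import Data.Unit.Base using (⊤)
open import Data.Vec.Base as Vec using (Vec; []; _∷_; lookup; _[_]≔_)
open import Data.Vec.Properties
  using ([]≔-idempotent; []≔-commutes; []≔-lookup; lookup∘update; lookup∘update′;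
         lookup∘tabulate; lookup⇒[]=; []=⇒lookup)
open import Function.Base using (id; _∘_; const; flip)
open import Function.Bundles using (mk⇔)
open import Relation.Binary.Definitions using (tri<; tri≈; tri>)
open import Relation.Binary.PropositionalEquality
  using (_≡_; _≢_; refl; sym; trans; cong; cong₂; subst; module ≡-Reasoning)
open import Relation.Nullary.Decidable using (Dec; yes; no; ¬?; _×-dec_)
open import Relation.Nullary.Negation using (¬_; contradiction)

-- Running times

-- Two mismatches shape the argument. The target problem asks for a β of weight k against every α,
-- even one that encodes no clique; for such an α extensibility of the empty clique supplies the set
-- of k vertices. And the size |C| + k of C ∪ D is not a condition on pairs of variables, but given
-- |D| = k it amounts to C and D being disjoint, which is one.
--
-- A yes-instance of the target problem only says that some circuit has the given encoding, so the
-- encoding of circuits has to be shown injective. Strings that encode no graph belong to the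
-- complement and must go to satisfiable circuits; to know that every other string does encode a
-- graph, the graph is rebuilt from a successful scan. The witness α cannot be read off a negated
-- statement and is found by exhaustive search.

module _ {A : Set} {t : ℕ} where

  -- Only an upper bound on the number of steps is tracked, so that branches of different cost can
  -- share one bound.
  Runs : Program A t → Store A t → Store A t → ℕ → Set
  Runs P σ τ b = ∃[ n ] n ≤ b × Run P σ n τ

  exactly : ∀ {P σ τ n} → Run P σ n τ → Runs P σ τ n
  exactly r = _ , ≤-refl , r

  weaken : ∀ {P σ τ b c} → b ≤ c → Runs P σ τ b → Runs P σ τ c
  weaken b≤c (n , n≤b , r) = n , ≤-trans n≤b b≤c , r

  infixr 5 _▷_
  _▷_ : ∀ {P Q σ ρ τ b c} → Runs P σ ρ b → Runs Q ρ τ c → Runs (P ⨾ Q) σ τ (b + c)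
  (m , m≤b , r) ▷ (n , n≤c , s) = m + n , +-mono-≤ m≤b n≤c , (r ⨾ s)

  ends-in : ∀ {P σ τ τ′ b} → τ ≡ τ′ → Runs P σ τ b → Runs P σ τ′ b
  ends-in refl r = r

  runs-push : ∀ {σ x a as τ} → lookup σ x ≡ as → σ [ x ]≔ (a ∷ as) ≡ τ →
              Runs (push x a) σ τ 1
  runs-push refl refl = exactly push

  runs-pop-[] : ∀ {σ τ x c b} → lookup σ x ≡ [] →
                Runs (c nothing) σ τ b → Runs (pop x c) σ τ (suc b)
  runs-pop-[] eq (n , n≤b , r) = suc n , s≤s n≤b , pop-[] eq r

  runs-pop-∷ : ∀ {σ ρ τ x c b a as} → lookup σ x ≡ a ∷ as → σ [ x ]≔ as ≡ ρ →
               Runs (c (just a)) ρ τ b → Runs (pop x c) σ τ (suc b)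
  runs-pop-∷ eq refl (n , n≤b , r) = suc n , s≤s n≤b , pop-∷ eq r

  -- Each round consumes one symbol of x, so the loop computes a left fold over the content of x and
  -- pays `b` plus one test per symbol. The embedding `ι` covers stacks that hold only part of the
  -- alphabet; `Inv` carries the size bounds that let one `b` serve all rounds.
  runs-while :
    {S B : Set} {P : Program A t} {x : Fin t} {b : ℕ}
    (ι : B → A) (store : S → List B → Store A t) (next : S → B → S)
    (Inv : S → List B → Set) →
    (∀ s r → lookup (store s r) x ≡ map ι r) →
    (∀ s a r → Inv s (a ∷ r) → Inv (next s a) r) →
    (∀ s a r → Inv s (a ∷ r) → Runs P (store s (a ∷ r)) (store (next s a) r) b) →
    ∀ s r → Inv s r →
    Runs (while x P) (store s r) (store (foldl next s r) []) (1 + length r * suc b)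
  runs-while ι store next Inv top inv body = go
    where
    go : ∀ s r → Inv s r → Runs _ (store s r) (store (foldl next s r) []) _
    go s []      i = exactly (stop (top s []))
    go s (a ∷ r) i with body s a r i | go (next s a) r (inv s a r i)
    ... | m , m≤b , p | n , n≤c , q =
      suc (m + n) ,
      s≤s (≤-trans (+-mono-≤ m≤b n≤c) (≤-reflexive (+-suc _ _))) ,
      loop (top s (a ∷ r)) p q

  move : Fin t → Fin t → Program A t
  move x y = while x (pop x (maybe (push y) skip))

  runs-move : ∀ {x y σ} {as bs : List A} → x ≢ y → lookup σ x ≡ as → lookup σ y ≡ bs →
              Runs (move x y) σ ((σ [ x ]≔ []) [ y ]≔ (as ʳ++ bs)) (3 * length as + 1)
  runs-move {x} {y} {σ} {as} {bs} x≢y refl refl =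
    subst (λ ρ → Runs (move x y) ρ (store (as ʳ++ bs) []) (3 * length as + 1)) initially
      (weaken (≤-reflexive (bound (length as)))
        (runs-while id store (flip _∷_) (λ _ _ → ⊤)
          (λ d r → trans (lookup-x d r) (sym (map-id r))) _
          (λ d a r _ → runs-pop-∷ (lookup-x d (a ∷ r)) (put-x d a r)
            (runs-push (lookup∘update y (σ [ x ]≔ r) d) ([]≔-idempotent (σ [ x ]≔ r) y)))
          bs as _))
    where
    store : List A → List A → Store A t
    store d r = (σ [ x ]≔ r) [ y ]≔ d
    lookup-x : ∀ d r → lookup (store d r) x ≡ r
    lookup-x d r = trans (lookup∘update′ x≢y (σ [ x ]≔ r) d) (lookup∘update x σ r)
    put-x : ∀ d a r → store d (a ∷ r) [ x ]≔ r ≡ store d r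
    put-x d a r = trans ([]≔-commutes (σ [ x ]≔ (a ∷ r)) y x (x≢y ∘ sym))
                        (cong (_[ y ]≔ d) ([]≔-idempotent σ x))
    initially : store bs as ≡ σ
    initially = trans (cong (_[ y ]≔ bs) ([]≔-lookup σ x)) ([]≔-lookup σ y)
    bound : ∀ n → 1 + n * 3 ≡ 3 * n + 1
    bound = solve-∀

  -- The stack u is auxiliary: it has to be empty, and x is restored from it.
  tallyOn : Fin t → Fin t → Fin t → A → Program A t
  tallyOn u z x a = while x (pop x (maybe (λ m → push u m ⨾ push z a) skip)) ⨾ move u x

  -- Per symbol there are four steps in the loop (test, pop, two pushes) and three in the move back.
  -- The content of x is reversed twice and so restored; the rest is commuting updates of three
  -- distinct stacks.
  runs-tallyOn : ∀ {u z x σ a} {as bs : List A} → x ≢ u → x ≢ z → u ≢ z →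
                 lookup σ x ≡ as → lookup σ u ≡ [] → lookup σ z ≡ bs →
                 Runs (tallyOn u z x a) σ (σ [ z ]≔ (replicate (length as) a ++ bs))
                      (7 * length as + 2)
  runs-tallyOn {u} {z} {x} {σ} {a} {as} {bs} x≢u x≢z u≢z refl u-empty refl =
    weaken (≤-reflexive bound)
      (subst (λ ρ → Runs (while x _) ρ (store (as ʳ++ []) []) (1 + length as * 4)) initially
         (runs-while id store (flip _∷_) (λ _ _ → ⊤)
           (λ d r → trans (lookup-x d r) (sym (map-id r))) _
           (λ d m r _ → runs-pop-∷ (lookup-x d (m ∷ r)) (put-x d m r)
             (runs-push (lookup-u d r) (put-u d m r) ▷
              runs-push (lookup∘update z (store₂ (m ∷ d) r) _) ([]≔-idempotent (store₂ (m ∷ d) r) z)))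
           [] as _)
       ▷ ends-in finally
           (runs-move (x≢u ∘ sym) (lookup-u (as ʳ++ []) []) (lookup-x (as ʳ++ []) [])))
    where
    tallies : List A → List A
    tallies d = replicate (length d) a ++ bs
    store : List A → List A → Store A t
    store d r = ((σ [ x ]≔ r) [ u ]≔ d) [ z ]≔ tallies d
    store₁ : List A → Store A t
    store₁ r = σ [ x ]≔ r
    store₂ : List A → List A → Store A t
    store₂ d r = store₁ r [ u ]≔ d
    lookup-x : ∀ d r → lookup (store d r) x ≡ r
    lookup-x d r = trans (lookup∘update′ x≢z (store₂ d r) _)
                  (trans (lookup∘update′ x≢u (store₁ r) d) (lookup∘update x σ r))
    lookup-u : ∀ d r → lookup (store d r) u ≡ d
    lookup-u d r = trans (lookup∘update′ u≢z (store₂ d r) _) (lookup∘update u (store₁ r) d)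
    put-x : ∀ d m r → store d (m ∷ r) [ x ]≔ r ≡ store d r
    put-x d m r = trans ([]≔-commutes (store₂ d (m ∷ r)) z x (x≢z ∘ sym)) (cong (_[ z ]≔ tallies d)
                 (trans ([]≔-commutes (store₁ (m ∷ r)) u x (x≢u ∘ sym)) (cong (_[ u ]≔ d)
                 ([]≔-idempotent σ x))))
    put-u : ∀ d m r → store d r [ u ]≔ (m ∷ d) ≡ ((σ [ x ]≔ r) [ u ]≔ (m ∷ d)) [ z ]≔ tallies d
    put-u d m r = trans ([]≔-commutes (store₂ d r) z u (u≢z ∘ sym)) (cong (_[ z ]≔ tallies d)
                 ([]≔-idempotent (store₁ r) u))
    initially : store [] as ≡ σ
    initially = trans (cong (λ ρ → (ρ [ u ]≔ []) [ z ]≔ bs) ([]≔-lookup σ x))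
               (trans (cong (λ v → (σ [ u ]≔ v) [ z ]≔ bs) (sym u-empty))
               (trans (cong (_[ z ]≔ bs) ([]≔-lookup σ u)) ([]≔-lookup σ z)))
    twice-reversed : (as ʳ++ []) ʳ++ [] ≡ as
    twice-reversed = reverse-involutive as
    finally : (store (as ʳ++ []) [] [ u ]≔ []) [ x ]≔ ((as ʳ++ []) ʳ++ [])
              ≡ σ [ z ]≔ (replicate (length as) a ++ bs)
    finally = begin
      (store rev [] [ u ]≔ []) [ x ]≔ (rev ʳ++ [])
        ≡⟨ cong (_[ x ]≔ _) (trans ([]≔-commutes (store₂ rev []) z u (u≢z ∘ sym))
                                   (cong (_[ z ]≔ tallies rev) ([]≔-idempotent (store₁ []) u))) ⟩
      (((σ [ x ]≔ []) [ u ]≔ []) [ z ]≔ tallies rev) [ x ]≔ (rev ʳ++ [])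
        ≡⟨ trans ([]≔-commutes (store₂ [] []) z x (x≢z ∘ sym)) (cong (_[ z ]≔ tallies rev)
          (trans ([]≔-commutes (store₁ []) u x (x≢u ∘ sym)) (cong (_[ u ]≔ [])
                 ([]≔-idempotent σ x)))) ⟩
      ((σ [ x ]≔ (rev ʳ++ [])) [ u ]≔ []) [ z ]≔ tallies rev
        ≡⟨ cong₂ (λ v w → ((σ [ x ]≔ v) [ u ]≔ []) [ z ]≔ (replicate w a ++ bs))
                 twice-reversed (length-reverse as) ⟩
      ((σ [ x ]≔ as) [ u ]≔ []) [ z ]≔ (replicate (length as) a ++ bs)
        ≡⟨ cong (_[ z ]≔ _) (trans (cong (_[ u ]≔ []) ([]≔-lookup σ x))
             (trans (cong (σ [ u ]≔_) (sym u-empty)) ([]≔-lookup σ u))) ⟩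
      σ [ z ]≔ (replicate (length as) a ++ bs) ∎
      where
      open ≡-Reasoning
      rev = as ʳ++ []
    bound : 1 + length as * 4 + (3 * length (as ʳ++ []) + 1) ≡ 7 * length as + 2
    bound = trans (cong (λ n → 1 + length as * 4 + (3 * n + 1)) (length-reverse as))
                  (arithmetic (length as))
      where
      arithmetic : ∀ n → 1 + n * 4 + (3 * n + 1) ≡ 7 * n + 2
      arithmetic = solve-∀

-- The leaves of a string

-- The conjunction of two variables, each in X (inX) or in Y (inY), with indices from P.
record Leaf (P : Set) : Set where
  constructor leaf
  field
    onlyX      : Bool
    left right : P ⊎ P

open Leaf

-- The machine knows indices only through its counters, so a template names them by their place.
-- This makes `templates` a finite table, shared by the specification and the program.
data Place : Set where
  row col : Place

at : ℕ → ℕ → Place → ℕ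
at r c row = r
at r c col = c

pattern inX i = inj₁ i
pattern inY i = inj₂ i

mapLeaf : {P Q : Set} → (P → Q) → Leaf P → Leaf Q
mapLeaf f (leaf b v w) = leaf b (Sum.map f f v) (Sum.map f f w)

-- A nonedge excludes that both its ends lie in C ∪ D, and no vertex lies in both C and D.
templates : Fin 4 → List (Leaf Place)
templates ‵in      = leaf false (inX row) (inY row) ∷ []
templates ‵out     = leaf true (inX row) (inX row) ∷ leaf false (inX row) (inY row) ∷ []
templates ‵edge    = []
templates ‵nonedge = leaf true (inX row) (inX col) ∷ leaf false (inX row) (inY col)
                   ∷ leaf false (inY row) (inX col) ∷ leaf false (inY row) (inY col) ∷ []

leavesAt : Fin 4 → ℕ → ℕ → List (Leaf ℕ)
leavesAt a r c = map (mapLeaf (at r c)) (templates a)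

-- Vertices are numbered from 1, and the dummy column 0 of each row counts as passed.  The leaves
-- are listed in the order of the gates, hence latest first.
record State : Set where
  constructor state
  field
    ahead passed faults : ℕ
    leaves              : List (Leaf ℕ)

open State

-- Here j and c do not count the symbol a being read, which therefore lies in row j + c + 1.
visit : Fin 4 → State → State
visit a (state j c e ls) = state j (suc c) e (leavesAt a (suc (j + c)) c ++ ls)

-- Each row has one entry more than the row before it. As the dummy column counts as passed, the
-- passed count of a finished row is exactly the number of entries ahead in the next. A vertex
-- symbol within an unfinished row is a fault.
openRow : Fin 4 → State → State
openRow a (state zero    c e ls) = visit a (state c 0 e ls)
openRow a (state (suc j) c e ls) = state (suc j) c (suc e) ls

readEntry : Fin 4 → State → State
readEntry a (state zero    c e ls) = state zero c (suc e) ls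
readEntry a (state (suc j) c e ls) = visit a (state j c e ls)

advance : State → Fin 4 → State
advance s ‵in      = openRow ‵in s
advance s ‵out     = openRow ‵out s
advance s ‵edge    = readEntry ‵edge s
advance s ‵nonedge = readEntry ‵nonedge s

dummy-y dummy-x : Leaf ℕ
dummy-y = leaf false (inY 0) (inY 0)
dummy-x = leaf true (inX 0) (inX 0)

initialState : State
initialState = state 0 0 0 (dummy-y ∷ [])

scan : List (Fin 4) → State
scan = foldl advance initialState

encodeVar : ℕ ⊎ ℕ → List (Fin 7)
encodeVar (inX i) = ‵x ∷ replicate i ‵tick
encodeVar (inY i) = ‵y ∷ replicate i ‵tick

encodeLeaf : Leaf ℕ → List (Fin 7)
encodeLeaf (leaf _ v w) = ‵conj ∷ encodeVar v ++ encodeVar w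

prependLeaves : List (Leaf ℕ) → List (Fin 7) → List (Fin 7)
prependLeaves ls w = foldr (λ l v → encodeLeaf l ++ v) w ls

encodeLeaves : List (Leaf ℕ) → List (Fin 7)
encodeLeaves ls = prependLeaves ls (encodeLeaf dummy-x)

-- The closing `true` is the kind of `dummy-x`, which ends every encoded list of leaves without
-- being listed.
kinds : List (Leaf ℕ) → List Bool
kinds ls = map onlyX ls ++ true ∷ []

-- In decreasing order, since a string is written from right to left.
indices : (Bool → Bool) → ℕ → List Bool → List ℕ
indices keep i []       = []
indices keep i (m ∷ ms) = indices keep (suc i) ms ++ (if keep m then i ∷ [] else [])

encodeIndices : List ℕ → List (Fin 7)
encodeIndices = concatMap (λ i → ‵gate ∷ replicate i ‵tick)

-- A malformed string is a yes-instance of the complement: x₀ becomes the output gate.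
acceptWord rejectWord : List (Fin 7)
acceptWord = ‵conj ∷ ‵gate ∷ ‵gate ∷ ‵tick ∷ ‵neg ∷ ‵gate ∷ ‵tick ∷ []
rejectWord = ‵conj ∷ ‵x ∷ []

encodeOr : (Bool → Bool) → ℕ → List (Leaf ℕ) → List (Fin 7)
encodeOr keep i ls = ‵disj ∷ encodeIndices (indices keep i (kinds ls))

encodeGatesOf : State → List (Fin 7)
encodeGatesOf (state zero    c zero    ls) =
  acceptWord ++ (encodeOr (const true) 1 ls ++ (encodeOr id 0 ls ++ encodeLeaves ls))
encodeGatesOf (state zero    c (suc e) ls) = rejectWord ++ encodeLeaves ls
encodeGatesOf (state (suc j) c e       ls) = rejectWord ++ encodeLeaves ls

-- The sum is constant within a row and equals the number of rows opened so far; it is the index of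
-- the current vertex and bounds all indices in the leaves.
size : State → ℕ
size s = ahead s + passed s

encodeState : State → List (Fin 7)
encodeState s = replicate (suc (size s)) ‵x ++ (replicate (suc (size s)) ‵y ++ encodeGatesOf s)

-- The machine

Symbol : Set
Symbol = Fin 4 ⊎ Fin 7 ⊎ Fin 2

out : Fin 7 → Symbol
out a = inj₂ (inj₁ a)

tick : Symbol
tick = inj₂ (inj₂ 0F)

mark : Bool → Symbol
mark false = tick
mark true  = inj₂ (inj₂ 1F)

unmark : Symbol → Bool
unmark (inj₂ (inj₂ 1F)) = true
unmark _                = false

ticks : ℕ → List Symbol
ticks n = replicate n tick

-- Stack 1F holds the parameter, which is not changed.
pattern #out    = 0F
pattern #in     = 2F
pattern #ahead  = 3F
pattern #passed = 4F
pattern #faults = 5F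
pattern #kinds  = 6F
pattern #spare  = 7F
pattern #seen   = 8F

Prog : Set
Prog = Program Symbol 9

write : List (Fin 7) → Prog
write []      = skip
write (a ∷ w) = write w ⨾ push #out (out a)

count : Fin 9 → Fin 7 → Prog
count x a = tallyOn #spare #out x (out a)

countRow : Fin 7 → Prog
countRow a = count #passed a ⨾ count #ahead a ⨾ push #out (out a)

writePlace : Place → Prog
writePlace row = countRow ‵tick
writePlace col = count #passed ‵tick

writeVar : Place ⊎ Place → Prog
writeVar (inX i) = writePlace i ⨾ push #out (out ‵x)
writeVar (inY i) = writePlace i ⨾ push #out (out ‵y)

writeLeaf : Leaf Place → Prog
writeLeaf (leaf b v w) =
  writeVar w ⨾ writeVar v ⨾ push #out (out ‵conj) ⨾ push #kinds (mark b)

writeLeaves : List (Leaf Place) → Prog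
writeLeaves []       = skip
writeLeaves (l ∷ ls) = writeLeaves ls ⨾ writeLeaf l

visitProg : Fin 4 → Prog
visitProg a = writeLeaves (templates a) ⨾ push #passed tick

openRowProg readEntryProg advanceProg : Fin 4 → Prog
openRowProg a = pop #ahead (maybe (λ m → push #ahead m ⨾ push #faults tick)
                                  (move #passed #ahead ⨾ visitProg a))
readEntryProg a = pop #ahead (maybe (λ _ → visitProg a) (push #faults tick))
advanceProg ‵in      = openRowProg ‵in
advanceProg ‵out     = openRowProg ‵out
advanceProg ‵edge    = readEntryProg ‵edge
advanceProg ‵nonedge = readEntryProg ‵nonedge

scanProg : Prog
scanProg = while #in (pop #in (maybe [ advanceProg , const skip ]′ skip))

-- The number of symbols on `#seen` is the index of the gate at the top of `#kinds`, so a wire is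
-- written by tallying `#seen`.
collect : (Bool → Bool) → Prog
collect keep =
  while #kinds (pop #kinds (maybe
    (λ m → (if keep (unmark m) then count #seen ‵tick ⨾ push #out (out ‵gate) else skip)
           ⨾ push #seen m)
    skip))
  ⨾ push #out (out ‵disj)

accept reject verdict reduction : Prog
-- The extra symbol on #seen accounts for the gate of the first disjunction, which the wires of the
-- second one have to skip.
accept = collect id ⨾ move #seen #kinds ⨾ push #seen tick ⨾ collect (const true) ⨾ write acceptWord
reject = write rejectWord
verdict = pop #ahead (maybe (λ m → push #ahead m ⨾ reject)
                            (pop #faults (maybe (const reject) accept)))
reduction =
  -- The input arrives on the stack that has to hold the output; moving it twice keeps its order.
  move #out #spare ⨾ move #spare #in ⨾
  -- All counters are still empty, so `col` stands for index 0 and these are the two dummy pairs.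
  writeLeaves (leaf false (inY col) (inY col) ∷ leaf true (inX col) (inX col) ∷ []) ⨾
  scanProg ⨾ verdict ⨾ countRow ‵y ⨾ countRow ‵x

-- Correctness and running time of the machine

board : List (Fin 7) → ℕ → List Symbol → ℕ → ℕ → ℕ → List Bool → List Bool → Store Symbol 9
board w k i j c e t d =
  map out w ∷ ticks k ∷ i ∷ ticks j ∷ ticks c ∷ ticks e ∷ map mark t ∷ [] ∷ map mark d ∷ []

runs-write : ∀ v {w} {ρ : Vec (List Symbol) 8} →
             Runs (write v) (map out w ∷ ρ) (map out (v ++ w) ∷ ρ) (1 + length v)
runs-write []      = exactly skip
runs-write (a ∷ v) = weaken (≤-reflexive (cong suc (+-comm (length v) 1)))
                            (runs-write v ▷ exactly push)

runs-count : ∀ {x a w as} {ρ : Vec (List Symbol) 8} → suc x ≢ #spare →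
             lookup ρ x ≡ as → lookup ρ 6F ≡ [] →
             Runs (count (suc x) a) (map out w ∷ ρ) (map out (replicate (length as) a ++ w) ∷ ρ)
                  (7 * length as + 2)
runs-count {a = a} {w} {as} {ρ} x≢spare top empty =
  ends-in (cong (_∷ ρ) (sym (trans (map-++ out (replicate (length as) a) w)
                                   (cong (_++ map out w) (map-replicate out (length as) a)))))
          (runs-tallyOn x≢spare (λ ()) (λ ()) top empty refl)

replicate-++ : ∀ {A : Set} m n {a : A} {w} →
               replicate m a ++ (replicate n a ++ w) ≡ replicate (m + n) a ++ w
replicate-++ zero    n = refl
replicate-++ (suc m) n = cong (_ ∷_) (replicate-++ m n)

runs-countRow : ∀ a {w k i j c e t d} →
  Runs (countRow a) (board w k i j c e t d)
       (board (replicate (suc (j + c)) a ++ w) k i j c e t d) (7 * (j + c) + 5)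
runs-countRow a {w} {k} {i} {j} {c} {e} {t} {d} =
  weaken (≤-reflexive bound)
    (runs-count (λ ()) refl refl ▷ runs-count (λ ()) refl refl ▷
     runs-push refl (cong (λ v → map out (a ∷ v) ∷ ρ) prefix))
  where
  ρ = ticks k ∷ i ∷ ticks j ∷ ticks c ∷ ticks e ∷ map mark t ∷ [] ∷ map mark d ∷ []
  prefix : replicate (length (ticks j)) a ++ (replicate (length (ticks c)) a ++ w)
           ≡ replicate (j + c) a ++ w
  prefix = trans (cong₂ (λ m n → replicate m a ++ (replicate n a ++ w))
                        (length-replicate j) (length-replicate c))
                 (replicate-++ j c)
  bound : 7 * length (ticks c) + 2 + (7 * length (ticks j) + 2 + 1) ≡ 7 * (j + c) + 5
  bound = trans (cong₂ (λ m n → 7 * n + 2 + (7 * m + 2 + 1))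
                       (length-replicate j) (length-replicate c))
                (arithmetic j c)
    where
    arithmetic : ∀ m n → 7 * n + 2 + (7 * m + 2 + 1) ≡ 7 * (m + n) + 5
    arithmetic = solve-∀

module _ {B k j c e : ℕ} (j+c≤B : j + c ≤ B) {i : List Symbol} {d : List Bool} where

  runs-writePlace : ∀ p {w t} →
    Runs (writePlace p) (board w k i j c e t d)
         (board (replicate (at (suc (j + c)) c p) ‵tick ++ w) k i j c e t d) (7 * B + 5)
  runs-writePlace row = weaken (+-monoˡ-≤ 5 (*-monoʳ-≤ 7 j+c≤B)) (runs-countRow ‵tick)
  runs-writePlace col {w} {t} =
    weaken (+-mono-≤ (*-monoʳ-≤ 7 (≤-trans (≤-reflexive (length-replicate c))
                                           (≤-trans (m≤n+m c j) j+c≤B)))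
                     (s≤s (s≤s z≤n)))
      (ends-in (cong (λ n → board (replicate n ‵tick ++ w) k i j c e t d) (length-replicate c))
        (runs-count (λ ()) refl refl))

  runs-writeVar : ∀ v {w t} →
    Runs (writeVar v) (board w k i j c e t d)
         (board (encodeVar (Sum.map (at (suc (j + c)) c) (at (suc (j + c)) c) v) ++ w) k i j c e t d)
         (7 * B + 5 + 1)
  runs-writeVar (inX p) = runs-writePlace p ▷ exactly push
  runs-writeVar (inY p) = runs-writePlace p ▷ exactly push

  runs-writeLeaf : ∀ l {w t} →
    let l′ = mapLeaf (at (suc (j + c)) c) l in
    Runs (writeLeaf l) (board w k i j c e t d)
         (board (encodeLeaf l′ ++ w) k i j c e (onlyX l′ ∷ t) d)
         (14 * B + 14)
  runs-writeLeaf (leaf b v₁ v₂) {w} {t} =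
    weaken (≤-reflexive (bound B))
      (runs-writeVar v₂ ▷ runs-writeVar v₁ ▷
       runs-push refl (cong (λ u → board (‵conj ∷ u) k i j c e t d)
                            (sym (++-assoc (code v₁) (code v₂) w)))
       ▷ exactly push)
    where
    code : Place ⊎ Place → List (Fin 7)
    code v = encodeVar (Sum.map (at (suc (j + c)) c) (at (suc (j + c)) c) v)
    bound : ∀ n → 7 * n + 5 + 1 + (7 * n + 5 + 1 + (1 + 1)) ≡ 14 * n + 14
    bound = solve-∀

  runs-writeLeaves : ∀ ls {w t} →
    let ls′ = map (mapLeaf (at (suc (j + c)) c)) ls in
    Runs (writeLeaves ls) (board w k i j c e t d)
         (board (prependLeaves ls′ w) k i j c e (map onlyX ls′ ++ t) d)
         (1 + length ls * (14 * B + 14))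
  runs-writeLeaves []       = exactly skip
  runs-writeLeaves (l ∷ ls) =
    weaken (≤-reflexive (cong suc (+-comm (length ls * (14 * B + 14)) (14 * B + 14))))
      (runs-writeLeaves ls ▷ runs-writeLeaf l)

stateBoard : ℕ → State → List (Fin 4) → Store Symbol 9
stateBoard k (state j c e ls) r = board (encodeLeaves ls) k (map inj₁ r) j c e (kinds ls) []

length-templates : ∀ a → length (templates a) ≤ 4
length-templates ‵in      = s≤s z≤n
length-templates ‵out     = s≤s (s≤s z≤n)
length-templates ‵edge    = z≤n
length-templates ‵nonedge = ≤-refl

-- The factor 56 comes from at most four leaves, each with two indices, at seven steps per unit of
-- an index.
runs-visit : ∀ a {B k r} s → size s ≤ B →
  Runs (visitProg a) (stateBoard k s r) (stateBoard k (visit a s) r) (56 * B + 58)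
runs-visit a {B} {k} {r} (state j c e ls) fits =
  weaken bound
    (ends-in (cong₂ (λ w t → board w k (map inj₁ r) j c e t [])
                    (sym (foldr-++ _ _ new ls))
                    (trans (sym (++-assoc (map onlyX new) (map onlyX ls) (true ∷ [])))
                           (cong (_++ true ∷ []) (sym (map-++ onlyX new ls)))))
       (runs-writeLeaves fits (templates a))
     ▷ exactly push)
  where
  new = leavesAt a (suc (j + c)) c
  arithmetic : ∀ n → 1 + 4 * (14 * n + 14) + 1 ≡ 56 * n + 58
  arithmetic = solve-∀
  bound : 1 + length (templates a) * (14 * B + 14) + 1 ≤ 56 * B + 58
  bound = ≤-trans (+-monoˡ-≤ 1 (s≤s (*-monoˡ-≤ (14 * B + 14) (length-templates a))))
                  (≤-reflexive (arithmetic B))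

ticks-ʳ++ : ∀ m n → ticks m ʳ++ ticks n ≡ ticks (m + n)
ticks-ʳ++ zero    n = refl
ticks-ʳ++ (suc m) n = trans (ticks-ʳ++ m (suc n)) (cong ticks (+-suc m n))

runs-openRow : ∀ a {B k r} s → size s ≤ B →
  Runs (openRowProg a) (stateBoard k s r) (stateBoard k (openRow a s) r) (59 * B + 60)
runs-openRow a {B} {k} {r} (state zero c e ls) fits =
  weaken bound
    (runs-pop-[] refl
      (ends-in (cong (λ u → map out (encodeLeaves ls) ∷ ticks k ∷ map inj₁ r ∷ u ∷ []
                            ∷ ticks e ∷ map mark (kinds ls) ∷ [] ∷ [] ∷ [])
                     (trans (ticks-ʳ++ c 0) (cong ticks (+-identityʳ c))))
         (runs-move (λ ()) refl refl)
       ▷ runs-visit a {r = r} (state c 0 e ls) (≤-trans (≤-reflexive (+-identityʳ c)) fits)))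
  where
  arithmetic : ∀ n → suc (3 * n + 1 + (56 * n + 58)) ≡ 59 * n + 60
  arithmetic = solve-∀
  bound : suc (3 * length (ticks c) + 1 + (56 * B + 58)) ≤ 59 * B + 60
  bound = ≤-trans
    (s≤s (+-monoˡ-≤ _ (+-monoˡ-≤ 1 (*-monoʳ-≤ 3 (≤-trans (≤-reflexive (length-replicate c)) fits)))))
    (≤-reflexive (arithmetic B))
runs-openRow a {B} (state (suc j) c e ls) fits =
  weaken (≤-trans (s≤s (s≤s (s≤s z≤n))) (m≤n+m 60 (59 * B)))
    (runs-pop-∷ refl refl (exactly push ▷ exactly push))

runs-readEntry : ∀ a {B k r} s → size s ≤ B →
  Runs (readEntryProg a) (stateBoard k s r) (stateBoard k (readEntry a s) r) (59 * B + 60)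
runs-readEntry a {B} (state zero    c e ls) fits =
  weaken (≤-trans (s≤s (s≤s z≤n)) (m≤n+m 60 (59 * B))) (runs-pop-[] refl (exactly push))
runs-readEntry a {B} {k} {r} (state (suc j) c e ls) fits =
  weaken (≤-trans (≤-reflexive (sym (+-suc (56 * B) 58)))
           (+-mono-≤ (*-monoˡ-≤ B {56} {59} (m≤m+n 56 3)) (m≤m+n 59 1)))
    (runs-pop-∷ refl refl (runs-visit a {r = r} (state j c e ls) (≤-trans (n≤1+n _) fits)))

runs-advance : ∀ a {B k r} s → size s ≤ B →
  Runs (advanceProg a) (stateBoard k s r) (stateBoard k (advance s a) r) (59 * B + 60)
runs-advance ‵in      {r = r} = runs-openRow ‵in {r = r}
runs-advance ‵out     {r = r} = runs-openRow ‵out {r = r}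
runs-advance ‵edge    {r = r} = runs-readEntry ‵edge {r = r}
runs-advance ‵nonedge {r = r} = runs-readEntry ‵nonedge {r = r}

-- With n symbols still to be read.
Bounded : ℕ → ℕ → State → Set
Bounded B n s = size s + n ≤ B × length (leaves s) + 4 * n ≤ 4 * B + 1

visit-bounded : ∀ a {B n} s → Bounded B (suc n) s → Bounded B n (visit a s)
visit-bounded a {B} {n} (state j c e ls) (fits , few) =
  ≤-trans (≤-reflexive (shift j c n)) fits ,
  ≤-trans (≤-trans (≤-reflexive (cong (_+ 4 * n) (length-++ (leavesAt a (suc (j + c)) c))))
          (≤-trans (+-monoˡ-≤ _ (+-monoˡ-≤ _ (≤-trans (≤-reflexive (length-map _ (templates a)))
                                                      (length-templates a))))
                   (≤-reflexive (regroup (length ls) n)))) few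
  where
  shift : ∀ j c n → j + suc c + n ≡ j + c + suc n
  shift = solve-∀
  regroup : ∀ m n → 4 + m + 4 * n ≡ m + 4 * suc n
  regroup = solve-∀

bounded-pred : ∀ {B n} s → Bounded B (suc n) s → Bounded B n s
bounded-pred {n = n} s (fits , few) =
  ≤-trans (+-monoʳ-≤ (size s) (n≤1+n n)) fits ,
  ≤-trans (+-monoʳ-≤ (length (leaves s)) (*-monoʳ-≤ 4 (n≤1+n n))) few

openRow-bounded : ∀ a {B n} s → Bounded B (suc n) s → Bounded B n (openRow a s)
openRow-bounded a (state zero c e ls) (fits , few) =
  visit-bounded a (state c 0 e ls)
    (≤-trans (≤-reflexive (cong (_+ _) (+-identityʳ c))) fits , few)
openRow-bounded a (state (suc j) c e ls) = bounded-pred (state (suc j) c e ls)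

readEntry-bounded : ∀ a {B n} s → Bounded B (suc n) s → Bounded B n (readEntry a s)
readEntry-bounded a (state zero c e ls) = bounded-pred (state zero c e ls)
readEntry-bounded a (state (suc j) c e ls) (fits , few) =
  visit-bounded a (state j c e ls) (≤-trans (n≤1+n _) fits , few)

-- A symbol raises the size by at most one and adds at most four leaves, so neither sum in `Bounded`
-- grows as symbols are read. The extra 1 there is `dummy-y`, present from the start.
advance-bounded : ∀ a {B n} s → Bounded B (suc n) s → Bounded B n (advance s a)
advance-bounded ‵in      = openRow-bounded ‵in
advance-bounded ‵out     = openRow-bounded ‵out
advance-bounded ‵edge    = readEntry-bounded ‵edge
advance-bounded ‵nonedge = readEntry-bounded ‵nonedge

scan-bounded : ∀ {B} r s → Bounded B (length r) s → Bounded B 0 (foldl advance s r)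
scan-bounded []      s b = b
scan-bounded (a ∷ r) s b = scan-bounded r (advance s a) (advance-bounded a s b)

initial-bounded : ∀ n → Bounded n n initialState
initial-bounded n = ≤-refl , ≤-reflexive (+-comm 1 (4 * n))

runs-scan : ∀ {k} r → let B = length r in
  Runs scanProg (stateBoard k initialState r) (stateBoard k (scan r) [])
       (1 + B * (59 * B + 62))
runs-scan {k} r =
  weaken (≤-reflexive (cong (λ n → 1 + length r * n) (per-symbol (length r))))
    (runs-while inj₁ (stateBoard k) advance (λ s u → Bounded (length r) (length u) s) (λ _ _ → refl)
      (λ s a u → advance-bounded a s)
      (λ s a u b → runs-pop-∷ refl refl
        (runs-advance a {r = u} s (≤-trans (m≤m+n (size s) (suc (length u))) (proj₁ b))))
      initialState r (initial-bounded (length r)))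
  where
  per-symbol : ∀ n → suc (suc (59 * n + 60)) ≡ 59 * n + 62
  per-symbol = solve-∀

collected : (Bool → Bool) → List Bool × List (Fin 7) → Bool → List Bool × List (Fin 7)
collected keep (d , w) m =
  m ∷ d , (if keep m then ‵gate ∷ replicate (length d) ‵tick ++ w else w)

foldl-collected : ∀ keep t d w →
  foldl (collected keep) (d , w) t ≡ (t ʳ++ d , encodeIndices (indices keep (length d) t) ++ w)
foldl-collected keep []      d w = refl
foldl-collected keep (m ∷ t) d w =
  trans (foldl-collected keep t (m ∷ d) _) (cong ((t ʳ++ (m ∷ d)) ,_) (prefix (keep m)))
  where
  rest = indices keep (suc (length d)) t
  prefix : ∀ b →
    encodeIndices rest ++ (if b then ‵gate ∷ replicate (length d) ‵tick ++ w else w)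
    ≡ encodeIndices (rest ++ (if b then length d ∷ [] else [])) ++ w
  prefix true = begin
    encodeIndices rest ++ (word ++ w)
      ≡⟨ ++-assoc (encodeIndices rest) word w ⟨
    (encodeIndices rest ++ word) ++ w
      ≡⟨ cong (λ v → (encodeIndices rest ++ v) ++ w) (++-identityʳ word) ⟨
    (encodeIndices rest ++ encodeIndices (length d ∷ [])) ++ w
      ≡⟨ cong (_++ w) (concatMap-++ _ rest (length d ∷ [])) ⟨
    encodeIndices (rest ++ length d ∷ []) ++ w ∎
    where
    open ≡-Reasoning
    word = ‵gate ∷ replicate (length d) ‵tick
  prefix false = cong (λ v → encodeIndices v ++ w) (sym (++-identityʳ rest))

unmark-mark : ∀ m → unmark (mark m) ≡ m
unmark-mark false = refl
unmark-mark true  = refl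

module _ {k j c e N : ℕ} where

  private
    config : List (Fin 7) → List Bool → List Bool → Store Symbol 9
    config w t d = board w k [] j c e t d

  runs-collect : ∀ keep {w} t d → length d + length t ≤ N →
    Runs (collect keep) (config w t d)
         (config (‵disj ∷ encodeIndices (indices keep (length d) t) ++ w) [] (t ʳ++ d))
         (2 + N * (7 * N + 6))
  runs-collect keep {w} t d fits =
    weaken bound
      (ends-in (cong (λ s → config (proj₂ s) [] (proj₁ s)) (foldl-collected keep t d w))
        (runs-while mark (λ s r → config (proj₂ s) r (proj₁ s)) (collected keep)
          (λ s r → length (proj₁ s) + length r ≤ N)
          (λ _ _ → refl)
          (λ s m r → ≤-trans (≤-reflexive (sym (+-suc (length (proj₁ s)) (length r)))))
          (λ s m r l → runs-pop-∷ refl refl (body s m r l))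
          (d , w) t fits)
      ▷ exactly push)
    where
    bound : 1 + length t * suc (suc (7 * N + 4)) + 1 ≤ 2 + N * (7 * N + 6)
    bound = ≤-trans (≤-reflexive (arithmetic (length t) N))
      (+-monoʳ-≤ 2 (*-monoˡ-≤ (7 * N + 6) (≤-trans (m≤n+m (length t) (length d)) fits)))
      where
      arithmetic : ∀ m n → 1 + m * suc (suc (7 * n + 4)) + 1 ≡ 2 + m * (7 * n + 6)
      arithmetic = solve-∀
    body : ∀ s m r → length (proj₁ s) + suc (length r) ≤ N →
      Runs ((if keep (unmark (mark m)) then count #seen ‵tick ⨾ push #out (out ‵gate) else skip)
            ⨾ push #seen (mark m))
           (config (proj₂ s) r (proj₁ s))
           (config (proj₂ (collected keep s m)) r (proj₁ (collected keep s m)))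
           (7 * N + 4)
    body (d , w) m r l rewrite unmark-mark m with keep m
    ... | true =
      weaken (≤-trans (≤-reflexive (arithmetic (length (map mark d))))
                      (+-monoˡ-≤ 4 (*-monoʳ-≤ 7 (≤-trans (≤-reflexive (length-map mark d))
                                                         (≤-trans (m≤m+n (length d) _) l)))))
        ((ends-in (cong (λ n → config (replicate n ‵tick ++ w) r d) (length-map mark d))
            (runs-count (λ ()) refl refl)
         ▷ exactly push)
        ▷ exactly push)
      where
      arithmetic : ∀ n → 7 * n + 2 + 1 + 1 ≡ 7 * n + 4
      arithmetic = solve-∀
    ... | false = weaken (≤-trans (s≤s (s≤s z≤n)) (m≤n+m 4 (7 * N))) (exactly skip ▷ exactly push)

  runs-restore : ∀ {w} t d → length d + length t ≤ N →
    Runs (move #seen #kinds) (config w t d) (config w (d ʳ++ t) []) (3 * N + 1)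
  runs-restore {w} t d fits =
    weaken (+-monoˡ-≤ 1 (*-monoʳ-≤ 3 (≤-trans (≤-reflexive (length-map mark d))
                                              (≤-trans (m≤m+n (length d) _) fits))))
      (ends-in (cong (λ u → map out w ∷ ticks k ∷ [] ∷ ticks j ∷ ticks c ∷ ticks e ∷ u ∷ [] ∷ [] ∷ [])
                     (sym (map-ʳ++ mark d)))
        (runs-move (λ ()) refl refl))

  -- Each of the two calls of `collect` writes at most N wires with at most N ticks, at seven steps
  -- per tick, whence 14 N². The successor in the hypothesis leaves room for the extra symbol on
  -- `#seen`.
  runs-accept : ∀ ls → suc (length (kinds ls)) ≤ N →
    Runs accept (config (encodeLeaves ls) (kinds ls) [])
         (config (acceptWord ++ (encodeOr (const true) 1 ls ++ (encodeOr id 0 ls ++ encodeLeaves ls)))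
                 [] (kinds ls ʳ++ (false ∷ [])))
         (14 * (N * N) + 15 * N + 14)
  runs-accept ls fits =
    weaken (≤-reflexive (arithmetic N))
      (runs-collect id (kinds ls) [] (≤-trans (n≤1+n _) fits)
       ▷ ends-in (cong (λ u → config (encodeOr id 0 ls ++ encodeLeaves ls) u [])
                       (reverse-involutive (kinds ls)))
           (runs-restore [] (kinds ls ʳ++ [])
             (≤-trans (≤-reflexive (trans (+-identityʳ _) (length-reverse (kinds ls))))
                      (≤-trans (n≤1+n _) fits)))
       ▷ exactly push
       -- Since `mark false` is `tick`, the extra symbol appears as `false ∷ []`, and the indices
       -- start from 1.
       ▷ runs-collect (const true) (kinds ls) (false ∷ []) fits
       ▷ runs-write acceptWord)
    where
    arithmetic : ∀ n → 2 + n * (7 * n + 6) + (3 * n + 1 + (1 + (2 + n * (7 * n + 6) + 8)))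
                       ≡ 14 * (n * n) + 15 * n + 14
    arithmetic = solve-∀

AfterVerdict : ℕ → State → Store Symbol 9 → Set
AfterVerdict k s τ = ∃[ e ] ∃[ t ] ∃[ d ]
  τ ≡ board (encodeGatesOf s) k [] (ahead s) (passed s) e t d

runs-verdict : ∀ {k N} s → suc (length (kinds (leaves s))) ≤ N →
  ∃[ τ ] Runs verdict (stateBoard k s []) τ (14 * (N * N) + 15 * N + 16) × AfterVerdict k s τ
runs-verdict {N = N} (state zero c zero ls) fits =
  _ , weaken (≤-reflexive (sym (trans (+-suc _ 15) (cong suc (+-suc _ 14)))))
        (runs-pop-[] refl (runs-pop-[] refl (runs-accept ls fits))) ,
  _ , _ , _ , refl
runs-verdict {N = N} (state zero c (suc e) ls) fits =
  _ , weaken (≤-trans (m≤m+n 5 11) (m≤n+m 16 (14 * (N * N) + 15 * N)))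
        (runs-pop-[] refl (runs-pop-∷ refl refl (runs-write rejectWord))) ,
  _ , _ , _ , refl
runs-verdict {N = N} (state (suc j) c e ls) fits =
  _ , weaken (≤-trans (m≤m+n 5 11) (m≤n+m 16 (14 * (N * N) + 15 * N)))
        (runs-pop-∷ refl refl (exactly push ▷ runs-write rejectWord)) ,
  _ , _ , _ , refl

-- For n symbols there are at most 4n + 1 listed leaves; with `dummy-x` and the extra symbol this
-- gives N = 4n + 3. The leading coefficient is 59 for the scan plus 14 · 16 for the disjunctions.
runs-reduction : ∀ r k → ∃[ rest ]
  Runs reduction (map inj₁ r ∷ ticks k ∷ [] ∷ [] ∷ [] ∷ [] ∷ [] ∷ [] ∷ [] ∷ [])
       (map out (encodeState (scan r)) ∷ ticks k ∷ rest)
       (283 * (length r * length r) + 478 * length r + 229)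
runs-reduction r k with scan-bounded r initialState (initial-bounded (length r))
... | fits , few with runs-verdict {k} {4 * length r + 3} (scan r)
        (≤-trans (s≤s (≤-reflexive (trans (length-++ (map onlyX (leaves (scan r))))
                                          (cong (_+ 1) (length-map onlyX (leaves (scan r)))))))
                 (≤-trans (s≤s (+-monoˡ-≤ 1 few′)) (≤-reflexive (tidy (length r)))))
  where
  few′ : length (leaves (scan r)) ≤ 4 * length r + 1
  few′ = ≤-trans (≤-reflexive (sym (+-identityʳ _))) few
  tidy : ∀ n → suc (4 * n + 1 + 1) ≡ 4 * n + 3
  tidy = solve-∀
... | _ , decides , e , t , d , refl =
  _ , weaken (≤-trans total (≤-reflexive (arithmetic (length r))))
    ( runs-move (λ ()) refl refl
    ▷ ends-in (cong (λ u → [] ∷ ticks k ∷ u ∷ [] ∷ [] ∷ [] ∷ [] ∷ [] ∷ [] ∷ [])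
                    (reverse-involutive (map inj₁ r)))
        (runs-move (λ ()) refl refl)
    ▷ runs-writeLeaves {B = 0} {j = 0} {c = 0} z≤n
        (leaf false (inY col) (inY col) ∷ leaf true (inX col) (inX col) ∷ [])
    ▷ runs-scan r
    ▷ decides
    ▷ runs-countRow ‵y
    ▷ runs-countRow ‵x)
  where
  cost : ℕ → ℕ → ℕ → ℕ → ℕ
  cost n a b m = 3 * a + 1 + (3 * b + 1 + (29 + (1 + n * (59 * n + 62)
    + (14 * ((4 * n + 3) * (4 * n + 3)) + 15 * (4 * n + 3) + 16 + (7 * m + 5 + (7 * m + 5))))))
  arithmetic : ∀ n →
    3 * n + 1 + (3 * n + 1 + (29 + (1 + n * (59 * n + 62)
    + (14 * ((4 * n + 3) * (4 * n + 3)) + 15 * (4 * n + 3) + 16 + (7 * n + 5 + (7 * n + 5))))))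
    ≡ 283 * (n * n) + 478 * n + 229
  arithmetic = solve-∀
  symbols : List Symbol
  symbols = map inj₁ r
  rows≤ : 7 * size (scan r) + 5 ≤ 7 * length r + 5
  rows≤ = +-monoˡ-≤ 5 (*-monoʳ-≤ 7 (≤-trans (m≤m+n _ 0) fits))
  total : cost (length r) (length symbols) (length (symbols ʳ++ [])) (size (scan r))
          ≤ cost (length r) (length r) (length r) (length r)
  total = ≤-trans
    (≤-reflexive (cong₂ (λ a b → cost (length r) a b (size (scan r)))
      (length-map inj₁ r) (trans (length-reverse symbols) (length-map inj₁ r))))
    (+-monoʳ-≤ (3 * length r + 1) (+-monoʳ-≤ (3 * length r + 1) (+-monoʳ-≤ 29
      (+-monoʳ-≤ (1 + length r * (59 * length r + 62)) (+-monoʳ-≤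
        (14 * ((4 * length r + 3) * (4 * length r + 3)) + 15 * (4 * length r + 3) + 16)
        (+-mono-≤ rows≤ rows≤))))))

-- Circuits

module _ {n : ℕ} where

  -- Leaves are produced before the number of vertices is known, hence carry plain numbers. The
  -- remainder makes the wire total, and it changes no index that is at most n.
  varWire : ∀ {m} → ℕ ⊎ ℕ → Wire (suc n) (suc n) m
  varWire v = input (Sum.map (_mod suc n) (_mod suc n) v)

  leafGate : ∀ {m} → Leaf ℕ → Gate (suc n) (suc n) m
  leafGate (leaf _ v w) = conj (varWire v ∷ varWire w ∷ [])

  leafGates : (ls : List (Leaf ℕ)) → Gates (suc n) (suc n) (suc (length ls))
  leafGates []       = leafGate dummy-x ∷ []
  leafGates (l ∷ ls) = leafGate l ∷ leafGates ls

kept : (Bool → Bool) → (ls : List (Leaf ℕ)) → List⁺ (Fin (suc (length ls)))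
kept keep []       = zero ∷ []
kept keep (l ∷ ls) = List⁺.map suc (kept keep ls) ⁺++ (if keep (onlyX l) then zero ∷ [] else [])

acceptCircuit rejectCircuit : ∀ n → List (Leaf ℕ) → Circuit (suc n) (suc n)
acceptCircuit n ls = circuit
  ( conj (gate 0F ∷ gate 1F ∷ [])
  -- Index 1 skips the disjunction of all pairs and reaches the one of pairs within X.
  ∷ neg (gate 1F)
  ∷ disj (List⁺.map (gate ∘ suc) (kept (const true) ls))
  ∷ disj (List⁺.map gate (kept id ls))
  ∷ leafGates ls )
rejectCircuit n ls = circuit (conj (varWire (inX 0) ∷ []) ∷ leafGates ls)

stateCircuit : (s : State) → Circuit (suc (size s)) (suc (size s))
stateCircuit s@(state zero    c zero    ls) = acceptCircuit (size s) ls
stateCircuit s@(state zero    c (suc e) ls) = rejectCircuit (size s) ls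
stateCircuit s@(state (suc j) c e       ls) = rejectCircuit (size s) ls

-- The written word is the encoding of the circuit

VarBelow : ℕ → ℕ ⊎ ℕ → Set
VarBelow n = [ _≤ n , _≤ n ]′

LeafBelow : ℕ → Leaf ℕ → Set
LeafBelow n (leaf _ v w) = VarBelow n v × VarBelow n w

VarBelow-mono : ∀ {m n} → m ≤ n → ∀ v → VarBelow m v → VarBelow n v
VarBelow-mono m≤n (inX i) i≤m = ≤-trans i≤m m≤n
VarBelow-mono m≤n (inY i) i≤m = ≤-trans i≤m m≤n

LeafBelow-mono : ∀ {m n} → m ≤ n → ∀ l → LeafBelow m l → LeafBelow n l
LeafBelow-mono m≤n (leaf _ v w) (p , q) = VarBelow-mono m≤n v p , VarBelow-mono m≤n w q

Sound : State → Set
Sound s = All (LeafBelow (size s)) (leaves s)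

visit-sound : ∀ a {m} s → m ≤ size (visit a s) → All (LeafBelow m) (leaves s) → Sound (visit a s)
visit-sound a (state j c e ls) m≤ sound =
  All.++⁺ (All.map⁺ (All.universal fresh (templates a)))
          (All.map (λ {l} → LeafBelow-mono m≤ l) sound)
  where
  place≤ : ∀ p → at (suc (j + c)) c p ≤ j + suc c
  place≤ row = ≤-reflexive (sym (+-suc j c))
  place≤ col = ≤-trans (n≤1+n c) (m≤n+m (suc c) j)
  fresh-var : ∀ v → VarBelow (j + suc c) (Sum.map (at (suc (j + c)) c) (at (suc (j + c)) c) v)
  fresh-var (inX p) = place≤ p
  fresh-var (inY p) = place≤ p
  fresh : ∀ l → LeafBelow (j + suc c) (mapLeaf (at (suc (j + c)) c) l)
  fresh (leaf _ v w) = fresh-var v , fresh-var w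

openRow-sound : ∀ a s → Sound s → Sound (openRow a s)
openRow-sound a (state zero    c e ls) = visit-sound a (state c 0 e ls) (m≤m+n c 1)
openRow-sound a (state (suc j) c e ls) = id

readEntry-sound : ∀ a s → Sound s → Sound (readEntry a s)
readEntry-sound a (state zero    c e ls) = id
readEntry-sound a (state (suc j) c e ls) =
  visit-sound a (state j c e ls) (≤-reflexive (sym (+-suc j c)))

advance-sound : ∀ a s → Sound s → Sound (advance s a)
advance-sound ‵in      = openRow-sound ‵in
advance-sound ‵out     = openRow-sound ‵out
advance-sound ‵edge    = readEntry-sound ‵edge
advance-sound ‵nonedge = readEntry-sound ‵nonedge

foldl-sound : ∀ r s → Sound s → Sound (foldl advance s r)
foldl-sound []      s sound = sound
foldl-sound (a ∷ r) s sound = foldl-sound r (advance s a) (advance-sound a s sound)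

scan-sound : ∀ r → Sound (scan r)
scan-sound r = foldl-sound r initialState ((z≤n , z≤n) ∷ [])

toℕ-mod : ∀ {n i} → i ≤ n → toℕ (i mod suc n) ≡ i
toℕ-mod i≤n = trans (toℕ-fromℕ< _) (m<n⇒m%n≡m (s≤s i≤n))

module _ {n : ℕ} where

  encode-varWire : ∀ {m} v → VarBelow n v → encodeWire {m = m} (varWire {n} v) ≡ encodeVar v
  encode-varWire (inX i) i≤n = cong (λ j → ‵x ∷ replicate j ‵tick) (toℕ-mod i≤n)
  encode-varWire (inY i) i≤n = cong (λ j → ‵y ∷ replicate j ‵tick) (toℕ-mod i≤n)

  encode-leafGate : ∀ {m} l {gs : Gates (suc n) (suc n) m} → LeafBelow n l →
                    encodeGates (leafGate l ∷ gs) ≡ encodeLeaf l ++ encodeGates gs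
  encode-leafGate (leaf _ v w) {gs} (p , q) = cong (λ u → ‵conj ∷ u ++ encodeGates gs)
    (cong₂ _++_ (encode-varWire v p) (trans (++-identityʳ _) (encode-varWire w q)))

  encode-leafGates : ∀ ls → All (LeafBelow n) ls → encodeGates (leafGates {n} ls) ≡ encodeLeaves ls
  encode-leafGates []       []       = refl
  encode-leafGates (l ∷ ls) (b ∷ bs) =
    trans (encode-leafGate l b) (cong (encodeLeaf l ++_) (encode-leafGates ls bs))

-- The list `kept` retains `dummy-x` unconditionally, to be nonempty, whereas `indices` tests its
-- kind, which is `true`; the hypothesis on `keep` reconciles the two.
indices-kept : ∀ keep → keep true ≡ true → ∀ i ls →
               indices keep i (kinds ls) ≡ map (λ j → i + toℕ j) (List⁺.toList (kept keep ls))
indices-kept keep k i []       rewrite k = cong (_∷ []) (sym (+-identityʳ i))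
indices-kept keep k i (l ∷ ls) = begin
  indices keep (suc i) (kinds ls) ++ _
    ≡⟨ cong₂ _++_ (indices-kept keep k (suc i) ls) (last (keep (onlyX l))) ⟩
  map (λ j → suc i + toℕ j) rest ++ map (λ j → i + toℕ j) newest
    ≡⟨ cong (_++ map (λ j → i + toℕ j) newest)
            (trans (map-cong (λ j → sym (+-suc i (toℕ j))) rest) (map-∘ rest)) ⟩
  map (λ j → i + toℕ j) (map suc rest) ++ map (λ j → i + toℕ j) newest
    ≡⟨ map-++ _ (map suc rest) newest ⟨
  map (λ j → i + toℕ j) (map suc rest ++ newest) ∎
  where
  open ≡-Reasoning
  rest = List⁺.toList (kept keep ls)
  newest = if keep (onlyX l) then zero ∷ [] else []
  last : ∀ b → (if b then i ∷ [] else [])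
         ≡ map (λ (j : Fin (suc (length (l ∷ ls)))) → i + toℕ j) (if b then zero ∷ [] else [])
  last true  = cong (_∷ []) (sym (+-identityʳ i))
  last false = refl

encode-or : ∀ {n m} keep → keep true ≡ true → ∀ i ls (f : Fin (suc (length ls)) → Fin m) →
            (∀ j → toℕ (f j) ≡ i + toℕ j) → {gs : Gates (suc n) (suc n) m} →
            encodeGates (disj (List⁺.map (gate ∘ f) (kept keep ls)) ∷ gs)
            ≡ encodeOr keep i ls ++ encodeGates gs
encode-or {n} keep k i ls f shifts {gs} = cong (λ w → ‵disj ∷ w ++ encodeGates gs) (begin
  concatMap encodeWire (map (gate ∘ f) js)
    ≡⟨ concatMap-map encodeWire (gate ∘ f) js ⟩
  concatMap (encodeWire {suc n} {suc n} ∘ gate ∘ f) js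
    ≡⟨ concatMap-cong (λ j → cong (λ t → ‵gate ∷ replicate t ‵tick) (shifts j)) js ⟩
  concatMap (λ j → ‵gate ∷ replicate (i + toℕ j) ‵tick) js
    ≡⟨ concatMap-map (λ t → ‵gate ∷ replicate t ‵tick) (λ j → i + toℕ j) js ⟨
  encodeIndices (map (λ j → i + toℕ j) js)
    ≡⟨ cong encodeIndices (indices-kept keep k i ls) ⟨
  encodeIndices (indices keep i (kinds ls)) ∎)
  where
  open ≡-Reasoning
  js = List⁺.toList (kept keep ls)

encode-acceptCircuit : ∀ {n} ls → All (LeafBelow n) ls →
  encodeGates (Circuit.gates (acceptCircuit n ls))
  ≡ acceptWord ++ (encodeOr (const true) 1 ls ++ (encodeOr id 0 ls ++ encodeLeaves ls))
encode-acceptCircuit ls sound = cong (acceptWord ++_)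
  (trans (encode-or (const true) refl 1 ls suc (λ _ → refl) {orA ∷ leafGates ls})
  (cong (encodeOr (const true) 1 ls ++_)
  (trans (encode-or id refl 0 ls id (λ _ → refl) {leafGates ls})
  (cong (encodeOr id 0 ls ++_) (encode-leafGates ls sound)))))
  where
  orA = disj (List⁺.map gate (kept id ls))

encode-stateCircuit : ∀ s → Sound s → encodeCircuit (stateCircuit s) ≡ encodeState s
encode-stateCircuit s sound =
  cong (λ w → replicate (suc (size s)) ‵x ++ (replicate (suc (size s)) ‵y ++ w)) (gates≡ s sound)
  where
  gates≡ : ∀ s → Sound s → encodeGates (Circuit.gates (stateCircuit s)) ≡ encodeGatesOf s
  gates≡ (state zero    c zero    ls) sound = encode-acceptCircuit ls sound
  gates≡ (state zero    c (suc e) ls) sound = cong (rejectWord ++_) (encode-leafGates ls sound)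
  gates≡ (state (suc j) c e       ls) sound = cong (rejectWord ++_) (encode-leafGates ls sound)

-- Values of the circuit

any-++ : ∀ {A : Set} (p : A → Bool) xs ys → any p (xs ++ ys) ≡ any p xs ∨ any p ys
any-++ p []       ys = refl
any-++ p (x ∷ xs) ys = trans (cong (p x ∨_) (any-++ p xs ys)) (sym (∨-assoc (p x) _ _))

any-map : ∀ {A B : Set} (p : B → Bool) (f : A → B) xs → any p (map f xs) ≡ any (p ∘ f) xs
any-map p f xs = cong (foldr _∨_ false) (sym (map-∘ xs))

module _ {n : ℕ} (α β : Assignment (suc n)) where

  True : ℕ ⊎ ℕ → Set
  True (inX i) = lookup α (i mod suc n) ≡ true
  True (inY i) = lookup β (i mod suc n) ≡ true

  Fires : Leaf ℕ → Set
  Fires (leaf _ v w) = True v × True w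

  Fails : Leaf ℕ → Set
  Fails l = onlyX l ≡ true × Fires l

  leafValue : ∀ {m} → Vec Bool m → Leaf ℕ → Bool
  leafValue v l = evalGate α β v (leafGate l)

  leafValue⁺ : ∀ {m} (v : Vec Bool m) l → Fires l → leafValue v l ≡ true
  leafValue⁺ v (leaf _ (inX i) (inX j)) (p , q) rewrite p | q = refl
  leafValue⁺ v (leaf _ (inX i) (inY j)) (p , q) rewrite p | q = refl
  leafValue⁺ v (leaf _ (inY i) (inX j)) (p , q) rewrite p | q = refl
  leafValue⁺ v (leaf _ (inY i) (inY j)) (p , q) rewrite p | q = refl

  ∧∧-true : ∀ a b → a ∧ (b ∧ true) ≡ true → a ≡ true × b ≡ true
  ∧∧-true true true _ = refl , refl

  leafValue⁻ : ∀ {m} (v : Vec Bool m) l → leafValue v l ≡ true → Fires l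
  leafValue⁻ v (leaf _ (inX i) (inX j)) = ∧∧-true _ _
  leafValue⁻ v (leaf _ (inX i) (inY j)) = ∧∧-true _ _
  leafValue⁻ v (leaf _ (inY i) (inX j)) = ∧∧-true _ _
  leafValue⁻ v (leaf _ (inY i) (inY j)) = ∧∧-true _ _

  leafValues : ∀ ls → Vec Bool (suc (length ls))
  leafValues ls = evalGates α β (leafGates ls)

  orValue : (Bool → Bool) → List (Leaf ℕ) → Bool
  orValue keep ls = any (lookup (leafValues ls)) (List⁺.toList (kept keep ls))

  orValue-∷ : ∀ keep l ls → orValue keep (l ∷ ls)
              ≡ orValue keep ls ∨ (keep (onlyX l) ∧ leafValue (leafValues ls) l)
  orValue-∷ keep l ls =
    trans (any-++ p (map suc rest) _)
          (cong₂ _∨_ (any-map p suc rest) (last (keep (onlyX l))))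
    where
    p = lookup (leafValues (l ∷ ls))
    rest = List⁺.toList (kept keep ls)
    last : ∀ b → any p (if b then zero ∷ [] else []) ≡ b ∧ leafValue (leafValues ls) l
    last true  = ∨-identityʳ _
    last false = refl

  orValue⁺ : ∀ keep ls → Any (λ l → keep (onlyX l) ≡ true × Fires l) ls → orValue keep ls ≡ true
  orValue⁺ keep (l ∷ ls) (here (k , f)) =
    trans (orValue-∷ keep l ls)
      (trans (cong (orValue keep ls ∨_) (cong₂ _∧_ k (leafValue⁺ (leafValues ls) l f))) (∨-zeroʳ _))
  orValue⁺ keep (l ∷ ls) (there a) =
    trans (orValue-∷ keep l ls)
      (cong (_∨ (keep (onlyX l) ∧ leafValue (leafValues ls) l)) (orValue⁺ keep ls a))

  orValue-dummy⁺ : ∀ keep ls → Fires dummy-x → orValue keep ls ≡ true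
  orValue-dummy⁺ keep []       f = cong (_∨ false) (leafValue⁺ [] dummy-x f)
  orValue-dummy⁺ keep (l ∷ ls) f =
    trans (orValue-∷ keep l ls)
      (cong (_∨ (keep (onlyX l) ∧ leafValue (leafValues ls) l)) (orValue-dummy⁺ keep ls f))

  orValue⁻ : ∀ keep ls → orValue keep ls ≡ true →
             Fires dummy-x ⊎ Any (λ l → keep (onlyX l) ≡ true × Fires l) ls
  orValue⁻ keep []       v = inj₁ (leafValue⁻ [] dummy-x (trans (sym (∨-identityʳ _)) v))
  orValue⁻ keep (l ∷ ls) v
    with orValue keep ls in rest | keep (onlyX l) in k | leafValue (leafValues ls) l in f
       | trans (sym (orValue-∷ keep l ls)) v
  ... | true  | _    | _    | _ = Sum.map id there (orValue⁻ keep ls rest)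
  ... | false | true | true | _ = inj₂ (here (k , leafValue⁻ _ l f))

  eval-acceptCircuit : ∀ ls → eval α β (acceptCircuit n ls)
                       ≡ not (orValue id ls) ∧ (orValue (const true) ls ∧ true)
  eval-acceptCircuit ls = cong₂ (λ a b → not a ∧ (b ∧ true))
    (any-map (evalWire α β (leafValues ls)) gate (List⁺.toList (kept id ls)))
    (any-map (evalWire α β (orA ∷ leafValues ls)) (gate ∘ suc) (List⁺.toList (kept (const true) ls)))
    where
    orA = evalGate α β (leafValues ls) (disj (List⁺.map gate (kept id ls)))

  -- The clause (x₀ , x₀) closes every list of leaves.
  OneOf : (Leaf ℕ → Set) → List (Leaf ℕ) → Set
  OneOf P ls = P dummy-x ⊎ Any P ls

  orFails⁺ : ∀ ls → OneOf Fails ls → orValue id ls ≡ true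
  orFails⁺ ls = [ (λ f → orValue-dummy⁺ id ls (proj₂ f)) , orValue⁺ id ls ]′

  orFails⁻ : ∀ ls → orValue id ls ≡ true → OneOf Fails ls
  orFails⁻ ls v = Sum.map₁ (refl ,_) (orValue⁻ id ls v)

  orFires⁺ : ∀ ls → OneOf Fires ls → orValue (const true) ls ≡ true
  orFires⁺ ls = [ orValue-dummy⁺ (const true) ls , orValue⁺ (const true) ls ∘ Any.map (refl ,_) ]′

  orFires⁻ : ∀ ls → orValue (const true) ls ≡ true → OneOf Fires ls
  orFires⁻ ls v = Sum.map₂ (Any.map proj₂) (orValue⁻ (const true) ls v)

  -- Either C, as encoded by α, needs no extension, or D is an extension without any clash.
  Refuted : List (Leaf ℕ) → Set
  Refuted ls = OneOf Fails ls ⊎ ¬ OneOf Fires ls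

  refuted⇒false : ∀ ls → Refuted ls → eval α β (acceptCircuit n ls) ≡ false
  refuted⇒false ls (inj₁ fails) = trans (eval-acceptCircuit ls)
    (cong (λ a → not a ∧ (orValue (const true) ls ∧ true)) (orFails⁺ ls fails))
  refuted⇒false ls (inj₂ none) = trans (eval-acceptCircuit ls)
    (trans (cong (λ b → not (orValue id ls) ∧ (b ∧ true)) (¬-not (none ∘ orFires⁻ ls)))
           (∧-zeroʳ _))

  false⇒refuted : ∀ ls → eval α β (acceptCircuit n ls) ≡ false → Refuted ls
  false⇒refuted ls v with orValue id ls in a | orValue (const true) ls in b
                        | trans (sym (eval-acceptCircuit ls)) v
  ... | true  | _     | _ = inj₁ (orFails⁻ ls a)
  ... | false | false | _ = inj₂ (λ f → contradiction (trans (sym b) (orFires⁺ ls f)) λ ())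

eval-rejectCircuit : ∀ n ls (α β : Assignment (suc n)) →
                     Vec.head α ≡ true → eval α β (rejectCircuit n ls) ≡ true
eval-rejectCircuit n ls (true ∷ α) β refl = refl

-- Depth and weft

module _ {n : ℕ} where

  Shallow : ∀ {m} (gs : Gates (suc n) (suc n) m) → Fin m → ℕ → ℕ → Set
  Shallow gs i u t = ∀ {l w} → Path gs i l w → l ≤ u × w ≤ t

  leafGates-shallow : ∀ ls i → Shallow (leafGates ls) i 1 0
  leafGates-shallow []             zero    (start _)                 = ≤-refl , z≤n
  leafGates-shallow []             zero    (step (here ()) _)
  leafGates-shallow []             zero    (step (there (here ())) _)
  leafGates-shallow (l ∷ ls)       zero    (start _)                 = ≤-refl , z≤n
  leafGates-shallow (leaf _ _ _ ∷ ls) zero (step (here ()) _)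
  leafGates-shallow (leaf _ _ _ ∷ ls) zero (step (there (here ())) _)
  leafGates-shallow (l ∷ ls)       (suc i) (older π)                 = leafGates-shallow ls i π

  large≤1 : ∀ {m} (g : Gate (suc n) (suc n) m) → large g ≤ 1
  large≤1 g with 2 <ᵇ length (wires g)
  ... | true  = ≤-refl
  ... | false = z≤n

  -- The wires lead to gates of weft 0, so the disjunction itself is the only gate on such a path
  -- that can be large.
  or-shallow : ∀ {m k u} (f : Fin k → Fin m) js {gs : Gates (suc n) (suc n) m} →
               (∀ j → Shallow gs (f j) u 0) →
               Shallow (disj (List⁺.map (gate ∘ f) js) ∷ gs) zero (suc u) 1
  or-shallow f js shallow (start x∈) with List.∈-map⁻ (gate ∘ f) x∈
  ... | _ , _ , ()
  or-shallow f js shallow (step {g = g} i∈ π) with List.∈-map⁻ (gate ∘ f) i∈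
  ... | j , _ , refl with shallow j π
  ... | l≤ , z≤n = s≤s l≤ , ≤-trans (≤-reflexive (+-identityʳ (large g))) (large≤1 g)

  -- A longest path runs through a leaf, the first disjunction, the negation and the output, hence
  -- depth 4.
  acceptCircuit-shallow : ∀ ls → Γ 1 4 (acceptCircuit n ls)
  acceptCircuit-shallow ls = at-output
    where
    at-orA : Shallow _ 0F 2 1
    at-orA = or-shallow id (kept id ls) {leafGates ls} (leafGates-shallow ls)
    at-orB : Shallow _ 0F 2 1
    at-orB = or-shallow suc (kept (const true) ls)
               {disj (List⁺.map gate (kept id ls)) ∷ leafGates ls}
               (λ j → λ { (older π) → leafGates-shallow ls j π })
    at-neg : Shallow (neg (gate 1F) ∷ _) 0F 3 1
    at-neg (start (here ()))
    at-neg (start (there ()))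
    at-neg (step (here refl) (older π)) with at-orA π
    ... | l≤ , w≤ = s≤s l≤ , w≤
    at-neg (step (there ()) _)
    at-output : Γ 1 4 (acceptCircuit n ls)
    at-output (start (there (here ())))
    at-output (step (here refl) π) with at-neg π
    ... | l≤ , w≤ = s≤s l≤ , w≤
    at-output (step (there (here refl)) (older π)) with at-orB π
    ... | l≤ , w≤ = s≤s (≤-trans l≤ (s≤s (s≤s z≤n))) , w≤

  rejectCircuit-shallow : ∀ ls → Γ 1 4 (rejectCircuit n ls)
  rejectCircuit-shallow ls (start _)          = s≤s z≤n , z≤n
  rejectCircuit-shallow ls (step (here ()) _)

stateCircuit-shallow : ∀ s → Γ 1 4 (stateCircuit s)
stateCircuit-shallow (state zero    c zero    ls) = acceptCircuit-shallow ls
stateCircuit-shallow (state zero    c (suc e) ls) = rejectCircuit-shallow ls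
stateCircuit-shallow (state (suc j) c e       ls) = rejectCircuit-shallow ls

-- Unique readability of circuits

-- Reading an encoding from right to left needs no look-ahead: the pending ticks
-- belong to the next wire, and the pending wires to the next connective.
WireCode GateCode Reading : Set
WireCode = Fin 7 × ℕ
GateCode = Fin 7 × List WireCode
Reading  = ℕ × List WireCode × List GateCode

readSymbol : Fin 7 → Reading → Reading
readSymbol ‵tick (n , ws , gs) = suc n , ws , gs
readSymbol ‵x    (n , ws , gs) = 0 , (‵x , n) ∷ ws , gs
readSymbol ‵y    (n , ws , gs) = 0 , (‵y , n) ∷ ws , gs
readSymbol ‵gate (n , ws , gs) = 0 , (‵gate , n) ∷ ws , gs
readSymbol ‵neg  (n , ws , gs) = 0 , [] , (‵neg , ws) ∷ gs
readSymbol ‵conj (n , ws , gs) = 0 , [] , (‵conj , ws) ∷ gs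
readSymbol ‵disj (n , ws , gs) = 0 , [] , (‵disj , ws) ∷ gs

decode : Reading → List (Fin 7) → Reading
decode = foldr readSymbol

decode-ticks : ∀ n {m ws gs} → decode (m , ws , gs) (replicate n ‵tick) ≡ (n + m , ws , gs)
decode-ticks zero    = refl
decode-ticks (suc n) = cong (readSymbol ‵tick) (decode-ticks n)

wireCode : ∀ {p q m} → Wire p q m → WireCode
wireCode (input (inj₁ i)) = ‵x , toℕ i
wireCode (input (inj₂ i)) = ‵y , toℕ i
wireCode (gate i)         = ‵gate , toℕ i

wireCode-injective : ∀ {p q m} {v w : Wire p q m} → wireCode v ≡ wireCode w → v ≡ w
wireCode-injective {v = input (inj₁ i)} {input (inj₁ j)} eq =
  cong (input ∘ inj₁) (toℕ-injective (,-injectiveʳ eq))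
wireCode-injective {v = input (inj₂ i)} {input (inj₂ j)} eq =
  cong (input ∘ inj₂) (toℕ-injective (,-injectiveʳ eq))
wireCode-injective {v = gate i} {gate j} eq = cong gate (toℕ-injective (,-injectiveʳ eq))
wireCode-injective {v = input (inj₁ i)} {input (inj₂ j)} ()
wireCode-injective {v = input (inj₁ i)} {gate j} ()
wireCode-injective {v = input (inj₂ i)} {input (inj₁ j)} ()
wireCode-injective {v = input (inj₂ i)} {gate j} ()
wireCode-injective {v = gate i} {input (inj₁ j)} ()
wireCode-injective {v = gate i} {input (inj₂ j)} ()

gateCodes : ∀ {p q m} → Gates p q m → List GateCode
gateCodes []       = []
gateCodes (g ∷ gs) = (connective g , map wireCode (wires g)) ∷ gateCodes gs

module _ {p q : ℕ} where

  decode-wire : ∀ {m} (w : Wire p q m) {ws gs} →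
                decode (0 , ws , gs) (encodeWire w) ≡ (0 , wireCode w ∷ ws , gs)
  decode-wire (input (inj₁ i)) = cong (readSymbol ‵x)
    (trans (decode-ticks (toℕ i)) (cong (_, _) (+-identityʳ (toℕ i))))
  decode-wire (input (inj₂ i)) = cong (readSymbol ‵y)
    (trans (decode-ticks (toℕ i)) (cong (_, _) (+-identityʳ (toℕ i))))
  decode-wire (gate i)         = cong (readSymbol ‵gate)
    (trans (decode-ticks (toℕ i)) (cong (_, _) (+-identityʳ (toℕ i))))

  decode-wires : ∀ {m} (us : List (Wire p q m)) {gs} →
                 decode (0 , [] , gs) (concatMap encodeWire us) ≡ (0 , map wireCode us , gs)
  decode-wires []       = refl
  decode-wires (u ∷ us) {gs} = begin
    decode (0 , [] , gs) (encodeWire u ++ concatMap encodeWire us)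
      ≡⟨ foldr-++ readSymbol _ (encodeWire u) _ ⟩
    decode (decode (0 , [] , gs) (concatMap encodeWire us)) (encodeWire u)
      ≡⟨ cong (λ r → decode r (encodeWire u)) (decode-wires us) ⟩
    decode (0 , map wireCode us , gs) (encodeWire u)
      ≡⟨ decode-wire u ⟩
    (0 , map wireCode (u ∷ us) , gs) ∎
    where open ≡-Reasoning

  decode-connective : ∀ {m} (g : Gate p q m) {ws gs} →
                      readSymbol (connective g) (0 , ws , gs) ≡ (0 , [] , (connective g , ws) ∷ gs)
  decode-connective (neg _)  = refl
  decode-connective (conj _) = refl
  decode-connective (disj _) = refl

  decode-gates : ∀ {m} (gs : Gates p q m) →
                 decode (0 , [] , []) (encodeGates gs) ≡ (0 , [] , gateCodes gs)
  decode-gates []       = refl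
  decode-gates (g ∷ gs) = trans
    (cong (readSymbol (connective g)) (begin
      decode (0 , [] , []) (concatMap encodeWire (wires g) ++ encodeGates gs)
        ≡⟨ foldr-++ readSymbol _ (concatMap encodeWire (wires g)) _ ⟩
      decode (decode (0 , [] , []) (encodeGates gs)) (concatMap encodeWire (wires g))
        ≡⟨ cong (λ r → decode r (concatMap encodeWire (wires g))) (decode-gates gs) ⟩
      decode (0 , [] , gateCodes gs) (concatMap encodeWire (wires g))
        ≡⟨ decode-wires (wires g) ⟩
      (0 , map wireCode (wires g) , gateCodes gs) ∎))
    (decode-connective g)
    where open ≡-Reasoning

decode-x : ∀ p {ws gs} → decode (0 , ws , gs) (replicate p ‵x) ≡ (0 , replicate p (‵x , 0) ++ ws , gs)
decode-x zero    = refl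
decode-x (suc p) = cong (readSymbol ‵x) (decode-x p)

decode-y : ∀ q {ws gs} → decode (0 , ws , gs) (replicate q ‵y) ≡ (0 , replicate q (‵y , 0) ++ ws , gs)
decode-y zero    = refl
decode-y (suc q) = cong (readSymbol ‵y) (decode-y q)

-- No connective precedes the declaration of the variables, so its symbols are left over as pending
-- wires without ticks.
inputCodes : ℕ → ℕ → List WireCode
inputCodes p q = replicate p (‵x , 0) ++ (replicate q (‵y , 0) ++ [])

decode-circuit : ∀ {p q} (C : Circuit p q) →
  decode (0 , [] , []) (encodeCircuit C) ≡ (0 , inputCodes p q , gateCodes (Circuit.gates C))
decode-circuit {p} {q} C = begin
  decode (0 , [] , []) (replicate p ‵x ++ (replicate q ‵y ++ body))
    ≡⟨ foldr-++ readSymbol _ (replicate p ‵x) _ ⟩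
  decode (decode (0 , [] , []) (replicate q ‵y ++ body)) (replicate p ‵x)
    ≡⟨ cong (λ r → decode r (replicate p ‵x)) (foldr-++ readSymbol _ (replicate q ‵y) body) ⟩
  decode (decode (decode (0 , [] , []) body) (replicate q ‵y)) (replicate p ‵x)
    ≡⟨ cong (λ r → decode (decode r (replicate q ‵y)) (replicate p ‵x)) (decode-gates (Circuit.gates C)) ⟩
  decode (decode (0 , [] , gateCodes (Circuit.gates C)) (replicate q ‵y)) (replicate p ‵x)
    ≡⟨ cong (λ r → decode r (replicate p ‵x)) (decode-y q) ⟩
  decode (0 , replicate q (‵y , 0) ++ [] , gateCodes (Circuit.gates C)) (replicate p ‵x)
    ≡⟨ decode-x p ⟩
  (0 , inputCodes p q , gateCodes (Circuit.gates C)) ∎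
  where
  open ≡-Reasoning
  body = encodeGates (Circuit.gates C)

inputCodes-injective : ∀ p q p′ q′ → inputCodes p q ≡ inputCodes p′ q′ → p ≡ p′ × q ≡ q′
inputCodes-injective zero    zero    zero    zero     eq = refl , refl
inputCodes-injective zero    (suc q) zero    (suc q′) eq =
  refl , cong suc (proj₂ (inputCodes-injective zero q zero q′ (∷-injectiveʳ eq)))
inputCodes-injective (suc p) q       (suc p′) q′      eq
  with inputCodes-injective p q p′ q′ (∷-injectiveʳ eq)
... | p≡p′ , q≡q′ = cong suc p≡p′ , q≡q′
inputCodes-injective zero    zero    zero    (suc q′) ()
inputCodes-injective zero    (suc q) zero    zero     ()
inputCodes-injective zero    zero    (suc p′) q′      ()
inputCodes-injective zero    (suc q) (suc p′) q′      ()
inputCodes-injective (suc p) q       zero    zero     ()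
inputCodes-injective (suc p) q       zero    (suc q′) ()

gate-injective : ∀ {p q m} (g h : Gate p q m) → connective g ≡ connective h → wires g ≡ wires h → g ≡ h
gate-injective (neg v)        (neg w)        _ refl = refl
gate-injective (conj (v ∷ vs)) (conj (w ∷ ws)) _ refl = refl
gate-injective (disj (v ∷ vs)) (disj (w ∷ ws)) _ refl = refl
gate-injective (neg _)  (conj _) () _
gate-injective (neg _)  (disj _) () _
gate-injective (conj _) (neg _)  () _
gate-injective (conj _) (disj _) () _
gate-injective (disj _) (neg _)  () _
gate-injective (disj _) (conj _) () _

-- The number of gates is not known to agree, hence the equality of pairs. The older gates are
-- compared before the newest one, because only then do the two newest gates have the same type.
gateCodes-injective : ∀ {p q m m′} (gs : Gates p q m) (gs′ : Gates p q m′) →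
                      gateCodes gs ≡ gateCodes gs′ → _≡_ {A = Σ ℕ (Gates p q)} (m , gs) (m′ , gs′)
gateCodes-injective []       []         eq = refl
gateCodes-injective (g ∷ gs) (g′ ∷ gs′) eq with ∷-injective eq
... | same , rest with gateCodes-injective gs gs′ rest
... | refl with ,-injective same
... | c , ws = cong (λ h → _ , h ∷ gs)
                    (gate-injective g g′ c (map-injective wireCode-injective ws))

SomeCircuit : Set
SomeCircuit = Σ ℕ λ p → Σ ℕ λ q → Circuit p q

-- This identifies the unknown circuit in a yes-instance of the satisfiability problem with the
-- constructed one.
encodeCircuit-injective : ∀ {p q p′ q′} (C : Circuit p q) (C′ : Circuit p′ q′) →
  encodeCircuit C ≡ encodeCircuit C′ → _≡_ {A = SomeCircuit} (p , q , C) (p′ , q′ , C′)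
encodeCircuit-injective {p} {q} {p′} {q′} C C′ eq
  with ,-injective (,-injectiveʳ
         (trans (sym (decode-circuit C)) (trans (cong (decode (0 , [] , [])) eq) (decode-circuit C′))))
... | inputs , gates with inputCodes-injective p q p′ q′ inputs
... | refl , refl with gateCodes-injective (Circuit.gates C) (Circuit.gates C′) gates
... | refl = refl

-- Refuting assignments and cliques

-- Later blocks come first, as the scan puts new leaves in front.
stacked : ∀ {X : Set} {n} → (Fin n → List X) → List X
stacked {n = zero}  block = []
stacked {n = suc n} block = stacked (block ∘ suc) ++ block zero

module _ {X : Set} {P : X → Set} where

  stacked⁺ : ∀ {n} (block : Fin n → List X) i → Any P (block i) → Any P (stacked block)
  stacked⁺ block zero    = Any.++⁺ʳ (stacked (block ∘ suc))
  stacked⁺ block (suc i) = Any.++⁺ˡ ∘ stacked⁺ (block ∘ suc) i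

  stacked⁻ : ∀ {n} (block : Fin n → List X) → Any P (stacked block) → ∃[ i ] Any P (block i)
  stacked⁻ {suc n} block a with Any.++⁻ (stacked (block ∘ suc)) a
  ... | inj₁ b = let i , c = stacked⁻ (block ∘ suc) b in suc i , c
  ... | inj₂ b = zero , b

-- Used at two levels: for the rows of the matrix, and for the entries of one row.
foldl-concat-tabulate :
  ∀ {S A X : Set} (f : S → A → S) (st : ℕ → List X → S)
    {n} (code : Fin n → List A) (block : Fin n → List X) →
  (∀ i ls → foldl f (st (toℕ i) ls) (code i) ≡ st (suc (toℕ i)) (block i ++ ls)) →
  ∀ ls → foldl f (st 0 ls) (concat (tabulate code)) ≡ st n (stacked block ++ ls)
foldl-concat-tabulate f st {zero}  code block adds ls = refl
foldl-concat-tabulate f st {suc n} code block adds ls = begin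
  foldl f (st 0 ls) (code zero ++ concat (tabulate (code ∘ suc)))
    ≡⟨ foldl-++ f _ (code zero) _ ⟩
  foldl f (foldl f (st 0 ls) (code zero)) (concat (tabulate (code ∘ suc)))
    ≡⟨ cong (λ s → foldl f s (concat (tabulate (code ∘ suc)))) (adds zero ls) ⟩
  foldl f (st 1 (block zero ++ ls)) (concat (tabulate (code ∘ suc)))
    ≡⟨ foldl-concat-tabulate f (st ∘ suc) (code ∘ suc) (block ∘ suc) (adds ∘ suc) _ ⟩
  st (suc n) (stacked (block ∘ suc) ++ (block zero ++ ls))
    ≡⟨ cong (st (suc n)) (++-assoc (stacked (block ∘ suc)) (block zero) ls) ⟨
  st (suc n) (stacked block ++ ls) ∎
  where open ≡-Reasoning

vertexCode entryCode : Bool → Fin 4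
vertexCode b = if b then ‵in else ‵out
entryCode b = if b then ‵edge else ‵nonedge

concat-singletons : ∀ {A : Set} {n} (f : Fin n → A) → concat (tabulate (λ i → f i ∷ [])) ≡ tabulate f
concat-singletons {n = zero}  f = refl
concat-singletons {n = suc n} f = cong (f zero ∷_) (concat-singletons (f ∘ suc))

advance-vertex : ∀ b m ls →
  advance (state 0 m 0 ls) (vertexCode b) ≡ state m 1 0 (leavesAt (vertexCode b) (suc m) 0 ++ ls)
advance-vertex true  m ls = cong (λ r → state m 1 0 (leavesAt ‵in (suc r) 0 ++ ls)) (+-identityʳ m)
advance-vertex false m ls = cong (λ r → state m 1 0 (leavesAt ‵out (suc r) 0 ++ ls)) (+-identityʳ m)

advance-entry : ∀ b j c ls →
  advance (state (suc j) c 0 ls) (entryCode b)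
  ≡ state j (suc c) 0 (leavesAt (entryCode b) (suc (j + c)) c ++ ls)
advance-entry true  j c ls = refl
advance-entry false j c ls = refl

module _ {n : ℕ} (G : Graph n) (V′ : Subset n) where

  open Graph G

  rowCode : Fin n → List (Fin 4)
  rowCode u = vertexCode (lookup V′ u)
            ∷ map (λ v → entryCode (adjacent u (inject v))) (allFin (toℕ u))

  vertexLeaves : Fin n → List (Leaf ℕ)
  vertexLeaves u = leavesAt (vertexCode (lookup V′ u)) (suc (toℕ u)) 0

  entryLeaves : (u : Fin n) → Fin (toℕ u) → List (Leaf ℕ)
  entryLeaves u v = leavesAt (entryCode (adjacent u (inject v))) (suc (toℕ u)) (suc (toℕ v))

  rowLeaves : Fin n → List (Leaf ℕ)
  rowLeaves u = stacked (entryLeaves u) ++ vertexLeaves u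

  graphLeaves : List (Leaf ℕ)
  graphLeaves = stacked rowLeaves ++ dummy-y ∷ []

  scan-row : ∀ u ls →
    foldl advance (state 0 (toℕ u) 0 ls) (rowCode u) ≡ state 0 (suc (toℕ u)) 0 (rowLeaves u ++ ls)
  scan-row u ls = begin
    foldl advance (advance (state 0 m 0 ls) (vertexCode (lookup V′ u))) entries
      ≡⟨ cong₂ (foldl advance) (advance-vertex (lookup V′ u) m ls)
               (trans (map-tabulate id code) (sym (concat-singletons code))) ⟩
    foldl advance (inRow 0 (vertexLeaves u ++ ls)) (concat (tabulate (λ v → code v ∷ [])))
      ≡⟨ foldl-concat-tabulate advance inRow (λ v → code v ∷ []) (entryLeaves u) scan-entry _ ⟩
    inRow m (stacked (entryLeaves u) ++ (vertexLeaves u ++ ls))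
      ≡⟨ cong₂ (λ j → state j (suc m) 0) (n∸n≡0 m)
               (sym (++-assoc (stacked (entryLeaves u)) (vertexLeaves u) ls)) ⟩
    state 0 (suc m) 0 (rowLeaves u ++ ls) ∎
    where
    open ≡-Reasoning
    m = toℕ u
    code : Fin m → Fin 4
    code v = entryCode (adjacent u (inject v))
    entries = map code (allFin m)
    -- After c entries c + 1 columns have been passed, the dummy column included.
    inRow : ℕ → List (Leaf ℕ) → State
    inRow c ls = state (m ∸ c) (suc c) 0 ls
    scan-entry : ∀ v ls → advance (inRow (toℕ v) ls) (code v)
                          ≡ inRow (suc (toℕ v)) (entryLeaves u v ++ ls)
    scan-entry v ls = begin
      advance (inRow (toℕ v) ls) (code v)
        -- As v lies within the row, the counter ahead is a successor and the symbol is not a fault.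
        ≡⟨ cong (λ j → advance (state j (suc (toℕ v)) 0 ls) (code v)) (+-∸-assoc 1 (toℕ<n v)) ⟩
      advance (state (suc (m ∸ suc (toℕ v))) (suc (toℕ v)) 0 ls) (code v)
        ≡⟨ advance-entry (adjacent u (inject v)) _ _ ls ⟩
      state (m ∸ suc (toℕ v)) (suc (suc (toℕ v))) 0
            (leavesAt (code v) (suc (m ∸ suc (toℕ v) + suc (toℕ v))) (suc (toℕ v)) ++ ls)
        ≡⟨ cong (λ r → state (m ∸ suc (toℕ v)) (suc (suc (toℕ v))) 0
                             (leavesAt (code v) (suc r) (suc (toℕ v)) ++ ls))
                (m∸n+n≡m (toℕ<n v)) ⟩
      inRow (suc (toℕ v)) (entryLeaves u v ++ ls) ∎

  encodeGraph-rows : encodeGraph G V′ ≡ concat (tabulate rowCode)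
  encodeGraph-rows = cong concat (map-tabulate id rowCode)

  scan-graph : scan (encodeGraph G V′) ≡ state 0 n 0 graphLeaves
  scan-graph = trans (cong scan encodeGraph-rows)
    (foldl-concat-tabulate advance (λ i ls → state 0 i 0 ls) rowCode rowLeaves scan-row (dummy-y ∷ []))

  module _ {P : Leaf ℕ → Set} where

    vertex⁺ : ∀ u → Any P (vertexLeaves u) → Any P graphLeaves
    vertex⁺ u = Any.++⁺ˡ ∘ stacked⁺ rowLeaves u ∘ Any.++⁺ʳ (stacked (entryLeaves u))

    entry⁺ : ∀ u v → Any P (entryLeaves u v) → Any P graphLeaves
    entry⁺ u v = Any.++⁺ˡ ∘ stacked⁺ rowLeaves u ∘ Any.++⁺ˡ ∘ stacked⁺ (entryLeaves u) v

    dummy-y⁺ : P dummy-y → Any P graphLeaves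
    dummy-y⁺ = Any.++⁺ʳ (stacked rowLeaves) ∘ here

    graphLeaves⁻ : Any P graphLeaves →
      P dummy-y ⊎ (∃[ u ] Any P (vertexLeaves u)) ⊎ (∃[ u ] ∃[ v ] Any P (entryLeaves u v))
    graphLeaves⁻ a with Any.++⁻ (stacked rowLeaves) a
    ... | inj₂ (here p) = inj₁ p
    ... | inj₁ b with stacked⁻ rowLeaves b
    ... | u , c with Any.++⁻ (stacked (entryLeaves u)) c
    ... | inj₁ d = let v , e = stacked⁻ (entryLeaves u) d in inj₂ (inj₂ (u , v , e))
    ... | inj₂ d = inj₂ (inj₁ (u , d))

toℕ-mod-toℕ : ∀ {n} (i : Fin (suc n)) → toℕ i mod suc n ≡ i
toℕ-mod-toℕ i = toℕ-injective (toℕ-mod (toℕ≤pred[n] i))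

∣p∪q∣+∣p∩q∣ : ∀ {n} (p q : Subset n) → ∣ p ∪ q ∣ + ∣ p ∩ q ∣ ≡ ∣ p ∣ + ∣ q ∣
∣p∪q∣+∣p∩q∣ []          []          = refl
∣p∪q∣+∣p∩q∣ (true  ∷ p) (true  ∷ q) = cong suc
  (trans (+-suc _ _) (trans (cong suc (∣p∪q∣+∣p∩q∣ p q)) (sym (+-suc _ _))))
∣p∪q∣+∣p∩q∣ (true  ∷ p) (false ∷ q) = cong suc (∣p∪q∣+∣p∩q∣ p q)
∣p∪q∣+∣p∩q∣ (false ∷ p) (true  ∷ q) = trans (cong suc (∣p∪q∣+∣p∩q∣ p q)) (sym (+-suc _ _))
∣p∪q∣+∣p∩q∣ (false ∷ p) (false ∷ q) = ∣p∪q∣+∣p∩q∣ p q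

-- With its converse below, this trades the size condition on C ∪ D for disjointness, which pairs of
-- variables can express.
disjoint⇒∣p∪q∣ : ∀ {n} (p q : Subset n) → (∀ {i} → i ∈ p → ¬ i ∈ q) → ∣ p ∪ q ∣ ≡ ∣ p ∣ + ∣ q ∣
disjoint⇒∣p∪q∣ {n} p q disjoint = begin
  ∣ p ∪ q ∣             ≡⟨ +-identityʳ _ ⟨
  ∣ p ∪ q ∣ + 0         ≡⟨ cong (∣ p ∪ q ∣ +_) (trans (cong ∣_∣ empty) (∣⊥∣≡0 n)) ⟨
  ∣ p ∪ q ∣ + ∣ p ∩ q ∣ ≡⟨ ∣p∪q∣+∣p∩q∣ p q ⟩
  ∣ p ∣ + ∣ q ∣         ∎
  where
  open ≡-Reasoning
  empty : p ∩ q ≡ ⊥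
  empty = Empty-unique λ (_ , i∈) → let i∈p , i∈q = x∈p∩q⁻ p q i∈ in disjoint i∈p i∈q

∣p∪q∣⇒disjoint : ∀ {n} (p q : Subset n) → ∣ p ∪ q ∣ ≡ ∣ p ∣ + ∣ q ∣ → ∀ {i} → i ∈ p → ¬ i ∈ q
∣p∪q∣⇒disjoint p q eq {i} i∈p i∈q = <⇒≢ (≤-<-trans z≤n (x∈p⇒∣p-x∣<∣p∣ (x∈p∩q⁺ (i∈p , i∈q)))) (sym none)
  where
  none : ∣ p ∩ q ∣ ≡ 0
  none = +-cancelˡ-≡ ∣ p ∪ q ∣ _ _
    (trans (∣p∪q∣+∣p∩q∣ p q) (trans (sym eq) (sym (+-identityʳ _))))

Extensible : ∀ {n} → Graph n → Subset n → ℕ → Set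
Extensible G V′ k = ∀ C → C ⊆ V′ → IsClique G C →
  ∃ λ D → IsCliqueOfSize G k D × IsCliqueOfSize G (∣ C ∣ + k) (C ∪ D)

module _ {n : ℕ} (G : Graph n) (V′ : Subset n) where

  open Graph G

  private
    ls : List (Leaf ℕ)
    ls = graphLeaves G V′

  module _ {a b : Bool} {C D : Subset n} where

    private
      α β : Assignment (suc n)
      α = a ∷ C
      β = b ∷ D

    x⁺ : ∀ {u} → u ∈ C → True α β (inX (suc (toℕ u)))
    x⁺ {u} u∈C = trans (cong (lookup α) (toℕ-mod-toℕ (suc u))) ([]=⇒lookup u∈C)

    y⁺ : ∀ {u} → u ∈ D → True α β (inY (suc (toℕ u)))
    y⁺ {u} u∈D = trans (cong (lookup β) (toℕ-mod-toℕ (suc u))) ([]=⇒lookup u∈D)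

    x⁻ : ∀ {u} → True α β (inX (suc (toℕ u))) → u ∈ C
    x⁻ {u} t = lookup⇒[]= u C (trans (sym (cong (lookup α) (toℕ-mod-toℕ (suc u)))) t)

    y⁻ : ∀ {u} → True α β (inY (suc (toℕ u))) → u ∈ D
    y⁻ {u} t = lookup⇒[]= u D (trans (sym (cong (lookup β) (toℕ-mod-toℕ (suc u)))) t)

    module _ {u v} (v<u : toℕ v < toℕ u) (apart : adjacent u v ≡ false) where

      private
        v′ : Fin (toℕ u)
        v′ = fromℕ< v<u
        v′≡v : inject v′ ≡ v
        v′≡v = toℕ-injective (trans (toℕ-inject v′) (toℕ-fromℕ< v<u))
        nonedge⁺ : ∀ {P} → Any P (leavesAt ‵nonedge (suc (toℕ u)) (suc (toℕ v))) → Any P ls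
        nonedge⁺ {P} = entry⁺ G V′ u v′ ∘ subst (Any P) (sym (cong₂
          (λ s c → leavesAt s (suc (toℕ u)) (suc c))
          (cong entryCode (trans (cong (adjacent u) v′≡v) apart)) (toℕ-fromℕ< v<u)))

      nonedge-fails : u ∈ C → v ∈ C → OneOf α β (Fails α β) ls
      nonedge-fails u∈ v∈ = inj₂ (nonedge⁺ (here (refl , x⁺ u∈ , x⁺ v∈)))

      nonedge-fires : u ∈ C ∪ D → v ∈ C ∪ D → OneOf α β (Fires α β) ls
      nonedge-fires u∈ v∈ with x∈p∪q⁻ C D u∈ | x∈p∪q⁻ C D v∈
      ... | inj₁ p | inj₁ q = inj₂ (nonedge⁺ (here (x⁺ p , x⁺ q)))
      ... | inj₁ p | inj₂ q = inj₂ (nonedge⁺ (there (here (x⁺ p , y⁺ q))))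
      ... | inj₂ p | inj₁ q = inj₂ (nonedge⁺ (there (there (here (y⁺ p , x⁺ q)))))
      ... | inj₂ p | inj₂ q = inj₂ (nonedge⁺ (there (there (there (here (y⁺ p , y⁺ q))))))

    -- Nonedges are recorded below the diagonal only; trichotomy and symmetry of adjacency supply
    -- the other order.
    clique-by : ∀ {S : Subset n} →
      (∀ {u v} → toℕ v < toℕ u → adjacent u v ≡ false → u ∈ S → ¬ v ∈ S) → IsClique G S
    clique-by noClash {u} {v} u∈ v∈ u≢v with adjacent u v in adj
    ... | true  = refl
    ... | false with <-cmp (toℕ u) (toℕ v)
    ...   | tri< u<v _ _ = contradiction u∈ (noClash u<v (trans (symmetric v u) adj) v∈)
    ...   | tri≈ _ u≡v _ = contradiction (toℕ-injective u≡v) u≢v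
    ...   | tri> _ _ v<u = contradiction v∈ (noClash v<u adj u∈)

    unfailing⇒clique : ¬ OneOf α β (Fails α β) ls → IsClique G C
    unfailing⇒clique none = clique-by λ v<u apart u∈ v∈ → none (nonedge-fails v<u apart u∈ v∈)

    unfailing⇒⊆ : ¬ OneOf α β (Fails α β) ls → C ⊆ V′
    unfailing⇒⊆ none {u} u∈C with lookup V′ u in u∈V′
    ... | true  = lookup⇒[]= u V′ u∈V′
    ... | false = contradiction
      (inj₂ (vertex⁺ G V′ u (subst (λ c → Any _ (leavesAt (vertexCode c) (suc (toℕ u)) 0)) (sym u∈V′)
                                   (here (refl , x⁺ u∈C , x⁺ u∈C)))))
      none

    unfiring⇒clique : ¬ OneOf α β (Fires α β) ls → IsClique G (C ∪ D)
    unfiring⇒clique none = clique-by λ v<u apart u∈ v∈ → none (nonedge-fires v<u apart u∈ v∈)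

    unfiring⇒disjoint : ¬ OneOf α β (Fires α β) ls → ∀ {u} → u ∈ C → ¬ u ∈ D
    unfiring⇒disjoint none {u} u∈C u∈D = none (inj₂ (vertex⁺ G V′ u (at-vertex (lookup V′ u))))
      where
      at-vertex : ∀ c → Any (Fires α β) (leavesAt (vertexCode c) (suc (toℕ u)) 0)
      at-vertex true  = here (x⁺ u∈C , y⁺ u∈D)
      at-vertex false = there (here (x⁺ u∈C , y⁺ u∈D))

    inject≢ : ∀ {u : Fin n} (v : Fin (toℕ u)) → u ≢ inject v
    inject≢ {u} v u≡v = <⇒≢ (toℕ<n v) (sym (trans (cong toℕ u≡v) (toℕ-inject v)))

    at-inject : ∀ {u : Fin n} {v : Fin (toℕ u)} (inZ : ℕ → ℕ ⊎ ℕ) →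
                True α β (inZ (suc (toℕ v))) → True α β (inZ (suc (toℕ (inject v))))
    at-inject {v = v} inZ = subst (λ i → True α β (inZ (suc i))) (sym (toℕ-inject v))

    unfailing : a ≡ false → C ⊆ V′ → IsClique G C → ¬ OneOf α β (Fails α β) ls
    unfailing refl C⊆V′ clique (inj₁ (_ , () , _))
    unfailing refl C⊆V′ clique (inj₂ some) with graphLeaves⁻ G V′ some
    ... | inj₁ (() , _)
    ... | inj₂ (inj₁ (u , f)) = at-vertex (lookup V′ u) refl f
      where
      at-vertex : ∀ c → lookup V′ u ≡ c → ¬ Any (Fails α β) (leavesAt (vertexCode c) (suc (toℕ u)) 0)
      at-vertex true  _   (here (() , _))
      at-vertex false u∉ (here (_ , u∈C , _)) =
        contradiction (trans (sym u∉) ([]=⇒lookup (C⊆V′ (x⁻ u∈C)))) λ ()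
      at-vertex false _   (there (here (() , _)))
    ... | inj₂ (inj₂ (u , v , f)) = at-entry (adjacent u (inject v)) refl f
      where
      at-entry : ∀ c → adjacent u (inject v) ≡ c →
                 ¬ Any (Fails α β) (leavesAt (entryCode c) (suc (toℕ u)) (suc (toℕ v)))
      at-entry true  _ ()
      at-entry false apart (here (_ , u∈C , v∈C)) = contradiction
        (trans (sym apart) (clique (x⁻ u∈C) (x⁻ (at-inject inj₁ v∈C)) (inject≢ v))) λ ()
      at-entry false _ (there (here (() , _)))
      at-entry false _ (there (there (here (() , _))))
      at-entry false _ (there (there (there (here (() , _)))))

    unfiring : ¬ OneOf α β (Fails α β) ls → b ≡ false → IsClique G (C ∪ D) →
               (∀ {u} → u ∈ C → ¬ u ∈ D) → ¬ OneOf α β (Fires α β) ls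
    unfiring none refl clique disjoint (inj₁ f) = none (inj₁ (refl , f))
    unfiring none refl clique disjoint (inj₂ some) with graphLeaves⁻ G V′ some
    ... | inj₁ (() , _)
    ... | inj₂ (inj₁ (u , f)) = at-vertex (lookup V′ u) refl f
      where
      at-vertex : ∀ c → lookup V′ u ≡ c → ¬ Any (Fires α β) (leavesAt (vertexCode c) (suc (toℕ u)) 0)
      at-vertex true  _  (here (u∈C , u∈D)) = disjoint (x⁻ u∈C) (y⁻ u∈D)
      -- A vertex outside V′ also carries a pair within X, which fires as soon as u ∈ C; this cannot
      -- happen, as a C that does not fail lies within V′.
      at-vertex false u∉ (here (u∈C , _)) =
        contradiction (trans (sym u∉) ([]=⇒lookup (unfailing⇒⊆ none (x⁻ u∈C)))) λ ()
      at-vertex false _  (there (here (u∈C , u∈D))) = disjoint (x⁻ u∈C) (y⁻ u∈D)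
    ... | inj₂ (inj₂ (u , v , f)) = at-entry (adjacent u (inject v)) refl f
      where
      at-entry : ∀ c → adjacent u (inject v) ≡ c →
                 ¬ Any (Fires α β) (leavesAt (entryCode c) (suc (toℕ u)) (suc (toℕ v)))
      clash : adjacent u (inject v) ≡ false → u ∈ C ∪ D → ¬ inject v ∈ C ∪ D
      clash apart u∈ v∈ = contradiction (trans (sym apart) (clique u∈ v∈ (inject≢ v))) λ ()
      inC : ∀ {w} → True α β (inX (suc (toℕ w))) → w ∈ C ∪ D
      inC t = p⊆p∪q D (x⁻ t)
      inD : ∀ {w} → True α β (inY (suc (toℕ w))) → w ∈ C ∪ D
      inD t = q⊆p∪q C D (y⁻ t)
      at-entry true  _ ()
      at-entry false e (here (p , q))                         = clash e (inC p) (inC (at-inject inj₁ q))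
      at-entry false e (there (here (p , q)))                 = clash e (inC p) (inD (at-inject inj₂ q))
      at-entry false e (there (there (here (p , q))))         = clash e (inD p) (inC (at-inject inj₁ q))
      at-entry false e (there (there (there (here (p , q))))) = clash e (inD p) (inD (at-inject inj₂ q))

  Refutable : ℕ → Set
  Refutable k = ∀ (α : Assignment (suc n)) →
    ∃ λ (β : Assignment (suc n)) → weight β ≡ k × Refuted α β ls

  -- If α fails, any β of weight k refutes, and extending the empty clique yields one. Otherwise x₀
  -- is false and C is a clique within V′, so that its own extension refutes. The value of the first
  -- disjunction decides between the cases.
  extensible⇒refutable : ∀ {k} → Extensible G V′ k → Refutable k
  extensible⇒refutable {k} ext (a ∷ C) with ext ⊥ ⊥⊆ (λ u∈ → contradiction u∈ ∉⊥)
  ... | D₀ , (_ , ∣D₀∣≡k) , _ with orValue (a ∷ C) (false ∷ D₀) id ls in fails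
  ... | true  = false ∷ D₀ , ∣D₀∣≡k , inj₁ (orFails⁻ _ _ ls fails)
  ... | false with unfails
    where
    unfails : ¬ OneOf (a ∷ C) (false ∷ D₀) (Fails (a ∷ C) (false ∷ D₀)) ls
    unfails f = contradiction (trans (sym fails) (orFails⁺ _ _ ls f)) λ ()
  ... | none with a-false
    where
    a-false : a ≡ false
    a-false = ¬-not λ { refl → none (inj₁ (refl , refl , refl)) }
  ... | refl with ext C (unfailing⇒⊆ none) (unfailing⇒clique none)
  ... | D , (_ , ∣D∣≡k) , clique , size≡ = false ∷ D , ∣D∣≡k , inj₂
    -- `Fails` is stated relative to β, so its absence for D₀ is derived anew for D from what it
    -- says about C.
    (unfiring (unfailing refl (unfailing⇒⊆ none) (unfailing⇒clique none)) refl clique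
      (∣p∪q∣⇒disjoint C D (trans size≡ (cong (∣ C ∣ +_) (sym ∣D∣≡k)))))

  -- With x₀ false a clique within V′ never fails, so the refuting β fires no pair. In particular
  -- `dummy-y` does not fire, hence y₀ is false and the whole weight k lies in D.
  refutable⇒extensible : ∀ {k} → Refutable k → Extensible G V′ k
  refutable⇒extensible {k} refute C C⊆V′ clique with refute (false ∷ C)
  ... | β , _ , inj₁ fails = contradiction fails (none β)
    where
    none : ∀ β → ¬ OneOf (false ∷ C) β (Fails (false ∷ C) β) ls
    none (b ∷ D) = unfailing refl C⊆V′ clique
  ... | true ∷ D , _ , inj₂ none = contradiction (inj₂ (dummy-y⁺ G V′ (refl , refl))) none
  ... | false ∷ D , ∣D∣≡k , inj₂ none =
    D , ((λ u∈ v∈ → unfiring⇒clique none (q⊆p∪q C D u∈) (q⊆p∪q C D v∈)) , ∣D∣≡k) ,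
    (unfiring⇒clique none , trans (disjoint⇒∣p∪q∣ C D (unfiring⇒disjoint none)) (cong (∣ C ∣ +_) ∣D∣≡k))

-- Malformed strings

Row : Set
Row = Bool × List Bool

entriesOf : Row → List Bool
entriesOf = proj₂

rowWord : Row → List (Fin 4)
rowWord (b , bits) = vertexCode b ∷ map entryCode bits

Staircase : ℕ → List Row → Set
Staircase m rows = ∀ u → length (entriesOf (List.lookup rows u)) ≡ m + toℕ u

-- The word completes the open row with the missing entries and adds further rows.
Completes : ℕ → ℕ → List (Fin 4) → Set
Completes j c I = ∃[ bits ] ∃[ rows ]
  length bits ≡ j × Staircase (j + c) rows × I ≡ map entryCode bits ++ concatMap rowWord rows

openRow-faults : ∀ a s → faults s ≤ faults (openRow a s)
openRow-faults a (state zero    c e ls) = ≤-refl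
openRow-faults a (state (suc j) c e ls) = n≤1+n e

readEntry-faults : ∀ a s → faults s ≤ faults (readEntry a s)
readEntry-faults a (state zero    c e ls) = n≤1+n e
readEntry-faults a (state (suc j) c e ls) = ≤-refl

advance-faults : ∀ a s → faults s ≤ faults (advance s a)
advance-faults ‵in      = openRow-faults ‵in
advance-faults ‵out     = openRow-faults ‵out
advance-faults ‵edge    = readEntry-faults ‵edge
advance-faults ‵nonedge = readEntry-faults ‵nonedge

foldl-faults : ∀ I s → faults s ≤ faults (foldl advance s I)
foldl-faults []      s = ≤-refl
foldl-faults (a ∷ I) s = ≤-trans (advance-faults a s) (foldl-faults I (advance s a))

Succeeds : State → Set
Succeeds s = ahead s ≡ 0 × faults s ≡ 0

-- The fault counter never decreases, so one fault is final.
fault⇒fails : ∀ I j c e ls → ¬ Succeeds (foldl advance (state j c (suc e) ls) I)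
fault⇒fails I j c e ls (_ , none) =
  contradiction (≤-trans (foldl-faults I (state j c (suc e) ls)) (≤-reflexive none)) λ ()

completes-vertex : ∀ b {c I} → Completes c 1 I → Completes 0 c (vertexCode b ∷ I)
completes-vertex b {c} (bits , rows , len , stairs , refl) =
  [] , (b , bits) ∷ rows , refl , stairs′ , refl
  where
  stairs′ : Staircase c ((b , bits) ∷ rows)
  stairs′ zero    = trans len (sym (+-identityʳ c))
  stairs′ (suc u) = trans (stairs u) (+-assoc c 1 (toℕ u))

completes-entry : ∀ b {j c I} → Completes j (suc c) I → Completes (suc j) c (entryCode b ∷ I)
completes-entry b {j} {c} (bits , rows , len , stairs , refl) =
  b ∷ bits , rows , cong suc len , (λ u → trans (stairs u) (cong (_+ toℕ u) (+-suc j c))) , refl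

-- By induction on the unread symbols: success forces every symbol to be of the kind that the
-- counter ahead demands, so the rows can be assembled from the end of the string.
succeeds⇒completes : ∀ I s → Succeeds (foldl advance s I) → Completes (ahead s) (passed s) I
succeeds⇒completes [] s (done , _) = [] , [] , sym done , (λ ()) , refl
succeeds⇒completes (‵in ∷ I) (state zero c e ls) ok =
  completes-vertex true (succeeds⇒completes I (openRow ‵in (state zero c e ls)) ok)
succeeds⇒completes (‵out ∷ I) (state zero c e ls) ok =
  completes-vertex false (succeeds⇒completes I (openRow ‵out (state zero c e ls)) ok)
succeeds⇒completes (‵edge ∷ I) (state (suc j) c e ls) ok =
  completes-entry true (succeeds⇒completes I (readEntry ‵edge (state (suc j) c e ls)) ok)
succeeds⇒completes (‵nonedge ∷ I) (state (suc j) c e ls) ok =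
  completes-entry false (succeeds⇒completes I (readEntry ‵nonedge (state (suc j) c e ls)) ok)
succeeds⇒completes (‵in ∷ I) (state (suc j) c e ls) ok = contradiction ok (fault⇒fails I (suc j) c e ls)
succeeds⇒completes (‵out ∷ I) (state (suc j) c e ls) ok = contradiction ok (fault⇒fails I (suc j) c e ls)
succeeds⇒completes (‵edge ∷ I) (state zero c e ls) ok = contradiction ok (fault⇒fails I zero c e ls)
succeeds⇒completes (‵nonedge ∷ I) (state zero c e ls) ok = contradiction ok (fault⇒fails I zero c e ls)

bit : List Bool → ℕ → Bool
bit []       _       = false
bit (b ∷ bs) zero    = b
bit (b ∷ bs) (suc i) = bit bs i

bit-beyond : ∀ bs {i} → length bs ≤ i → bit bs i ≡ false
bit-beyond []       _         = refl
bit-beyond (b ∷ bs) (s≤s len) = bit-beyond bs len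

tabulate-bit : ∀ {A : Set} (f : Bool → A) bs →
               tabulate {n = length bs} (λ i → f (bit bs (toℕ i))) ≡ map f bs
tabulate-bit f []       = refl
tabulate-bit f (b ∷ bs) = cong (f b ∷_) (tabulate-bit f bs)

module _ (rows : List Row) (stairs : Staircase 0 rows) where

  private
    n = length rows
    bitsOf : Fin n → List Bool
    bitsOf = entriesOf ∘ List.lookup rows

  -- For u ≠ v only one of the two bits lies within its row; the other one is false.
  rowsGraph : Graph n
  rowsGraph = record
    { adjacent    = λ u v → bit (bitsOf u) (toℕ v) ∨ bit (bitsOf v) (toℕ u)
    ; symmetric   = λ u v → ∨-comm (bit (bitsOf u) (toℕ v)) (bit (bitsOf v) (toℕ u))
    ; irreflexive = λ v → cong₂ _∨_ (off-diagonal v) (off-diagonal v)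
    }
    where
    off-diagonal : ∀ v → bit (bitsOf v) (toℕ v) ≡ false
    off-diagonal v = bit-beyond (bitsOf v) (≤-reflexive (stairs v))

  rowsSubset : Subset n
  rowsSubset = Vec.tabulate (proj₁ ∘ List.lookup rows)

  encode-rowsGraph : encodeGraph rowsGraph rowsSubset ≡ concatMap rowWord rows
  encode-rowsGraph = begin
    encodeGraph rowsGraph rowsSubset
      ≡⟨ encodeGraph-rows rowsGraph rowsSubset ⟩
    concat (tabulate (rowCode rowsGraph rowsSubset))
      ≡⟨ cong concat (tabulate-cong row≡) ⟩
    concat (tabulate (rowWord ∘ List.lookup rows))
      ≡⟨ cong concat (map-tabulate (List.lookup rows) rowWord) ⟨
    concat (map rowWord (tabulate (List.lookup rows)))
      ≡⟨ cong (concatMap rowWord) (tabulate-lookup rows) ⟩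
    concatMap rowWord rows ∎
    where
    open ≡-Reasoning
    open Graph rowsGraph
    adjacent≡ : ∀ u v → adjacent u (inject v) ≡ bit (bitsOf u) (toℕ v)
    adjacent≡ u v = trans
      (cong₂ _∨_ (cong (bit (bitsOf u)) (toℕ-inject v))
        (bit-beyond (bitsOf (inject v)) (≤-trans
          (≤-reflexive (trans (stairs (inject v)) (toℕ-inject v))) (<⇒≤ (toℕ<n v)))))
      (∨-identityʳ _)
    entries≡ : ∀ u → map (λ v → entryCode (adjacent u (inject v))) (allFin (toℕ u))
                     ≡ map entryCode (bitsOf u)
    entries≡ u = begin
      map (λ v → entryCode (adjacent u (inject v))) (allFin (toℕ u))
        ≡⟨ map-cong (λ v → cong entryCode (adjacent≡ u v)) (allFin (toℕ u)) ⟩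
      map (λ v → entryCode (bit (bitsOf u) (toℕ v))) (allFin (toℕ u))
        ≡⟨ map-tabulate id _ ⟩
      tabulate {n = toℕ u} (λ v → entryCode (bit (bitsOf u) (toℕ v)))
        ≡⟨ cong (λ m → tabulate {n = m} (λ v → entryCode (bit (bitsOf u) (toℕ v)))) (stairs u) ⟨
      tabulate {n = length (bitsOf u)} (λ v → entryCode (bit (bitsOf u) (toℕ v)))
        ≡⟨ tabulate-bit entryCode (bitsOf u) ⟩
      map entryCode (bitsOf u) ∎
    row≡ : ∀ u → rowCode rowsGraph rowsSubset u ≡ rowWord (List.lookup rows u)
    row≡ u = cong₂ _∷_ (cong vertexCode (lookup∘tabulate (proj₁ ∘ List.lookup rows) u)) (entries≡ u)

IsGraph : List (Fin 4) → Set
IsGraph I = ∃[ n ] ∃ λ (G : Graph n) → ∃ λ (V′ : Subset n) → I ≡ encodeGraph G V′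

succeeds⇒graph : ∀ I → Succeeds (scan I) → IsGraph I
succeeds⇒graph I ok with succeeds⇒completes I initialState ok
... | [] , rows , _ , stairs , I≡ =
  length rows , rowsGraph rows stairs , rowsSubset rows stairs ,
  trans I≡ (sym (encode-rowsGraph rows stairs))

-- Correctness of the reduction

WSatYes : List (Fin 7) → ℕ → Set
WSatYes = Problem.Yes (∃*∀ᵏ-WSat (Γ 1 4))

module _ {n : ℕ} (G : Graph n) (V′ : Subset n) (k : ℕ) where

  private
    ls = graphLeaves G V′
    C  = acceptCircuit n ls

  encode-graph : encodeState (scan (encodeGraph G V′)) ≡ encodeCircuit C
  encode-graph = trans
    (sym (encode-stateCircuit (scan (encodeGraph G V′)) (scan-sound (encodeGraph G V′))))
    (cong (λ s → encodeCircuit (stateCircuit s)) (scan-graph G V′))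

  -- There are finitely many assignments, so whether every α is refuted can be decided by search. If
  -- so, the graph would be extensible; if not, the search returns the α needed.
  inextensible⇒satisfiable : ¬ Extensible G V′ k → WSatYes (encodeCircuit C) k
  inextensible⇒satisfiable inext with anySubset? (λ α → ¬? (refuting? α))
    where
    refuting? : ∀ α → Dec (∃ λ β → weight β ≡ k × eval α β C ≡ false)
    refuting? α = anySubset? λ β → (weight β ≟ k) ×-dec (eval α β C Bool.≟ false)
  ... | yes (α , unrefuted) =
    _ , _ , C , refl , acceptCircuit-shallow ls , α , λ β w → ¬-not λ v → unrefuted (β , w , v)
  ... | no none = contradiction (refutable⇒extensible G V′ refutable) inext
    where
    refutable : Refutable G V′ k
    refutable α with anySubset? (λ β → (weight β ≟ k) ×-dec (eval α β C Bool.≟ false))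
    ... | yes (β , w , v) = β , w , false⇒refuted α β ls v
    ... | no unrefuted    = contradiction (α , unrefuted) none

  satisfiable⇒inextensible : WSatYes (encodeCircuit C) k → ¬ Extensible G V′ k
  satisfiable⇒inextensible (_ , _ , C′ , same , _ , α , sat) ext with encodeCircuit-injective C C′ same
  ... | refl with extensible⇒refutable G V′ ext α
  ... | β , w , refuted = contradiction (trans (sym (sat β w)) (refuted⇒false α β ls refuted)) λ ()

-- Any α with x₀ true satisfies the circuit, whatever β is.
reject-satisfiable : ∀ n ls k → WSatYes (encodeCircuit (rejectCircuit n ls)) k
reject-satisfiable n ls k =
  _ , _ , rejectCircuit n ls , refl , rejectCircuit-shallow ls , Vec.replicate (suc n) true ,
  λ β _ → eval-rejectCircuit n ls (Vec.replicate (suc n) true) β refl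

succeeds? : ∀ I k → Succeeds (scan I) ⊎ WSatYes (encodeState (scan I)) k
succeeds? I k =
  Sum.map₂ (subst (λ w → WSatYes w k) (encode-stateCircuit (scan I) (scan-sound I))) (go (scan I))
  where
  go : ∀ s → Succeeds s ⊎ WSatYes (encodeCircuit (stateCircuit s)) k
  go (state zero    c zero    ls) = inj₁ (refl , refl)
  go (state zero    c (suc e) ls) = inj₂ (reject-satisfiable c ls k)
  go (state (suc j) c e       ls) = inj₂ (reject-satisfiable (suc j + c) ls k)

no⇒satisfiable : ∀ I k → ¬ Problem.Yes SmallCliqueExtension I k → WSatYes (encodeState (scan I)) k
no⇒satisfiable I k no-extension with succeeds? I k
... | inj₂ sat = sat
... | inj₁ ok with succeeds⇒graph I ok
... | n , G , V′ , refl = subst (λ w → WSatYes w k) (sym (encode-graph G V′ k))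
  (inextensible⇒satisfiable G V′ k λ ext → no-extension (n , G , V′ , refl , ext))

satisfiable⇒no : ∀ I k → WSatYes (encodeState (scan I)) k → ¬ Problem.Yes SmallCliqueExtension I k
satisfiable⇒no _ k sat (n , G , V′ , refl , ext) =
  satisfiable⇒inextensible G V′ k (subst (λ w → WSatYes w k) (encode-graph G V′ k) sat) ext

-- For n ≥ 1 the square absorbs the lower terms, and the factor k + 1 is at least 1.
quadratic≤ : ∀ a b c k n → 1 ≤ n → a * (n * n) + b * n + c ≤ (a + b + c) * (suc k * n ^ 2)
quadratic≤ a b c k n 1≤n = begin
  a * (n * n) + b * n + c             ≤⟨ +-mono-≤ (+-monoʳ-≤ (a * (n * n)) (*-monoʳ-≤ b n≤n²)) c≤ ⟩
  a * (n * n) + b * (n * n) + c * (n * n)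
    ≡⟨ trans (cong (_+ c * (n * n)) (sym (*-distribʳ-+ (n * n) a b)))
             (sym (*-distribʳ-+ (n * n) (a + b) c)) ⟩
  (a + b + c) * (n * n)               ≡⟨ cong (λ m → (a + b + c) * (n * m)) (*-identityʳ n) ⟨
  (a + b + c) * n ^ 2                 ≤⟨ *-monoʳ-≤ (a + b + c) (m≤m+n (n ^ 2) (k * n ^ 2)) ⟩
  (a + b + c) * (suc k * n ^ 2)       ∎
  where
  open ≤-Reasoning
  n≤n² : n ≤ n * n
  n≤n² = ≤-trans (≤-reflexive (sym (*-identityʳ n))) (*-monoʳ-≤ n 1≤n)
  c≤ : c ≤ c * (n * n)
  c≤ = ≤-trans (≤-reflexive (sym (*-identityʳ c))) (*-monoʳ-≤ c (≤-trans 1≤n n≤n²))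

propositionB36 : ∀*∃ᵏ-W[1] SmallCliqueExtension
propositionB36 = 4 , s≤s z≤n , record
  { instanceOf   = λ I _ → encodeState (scan I)
  ; parameterOf  = λ _ k → k
  ; correct      = λ I k → mk⇔ (no⇒satisfiable I k) (satisfiable⇒no I k)
  ; g            = id
  ; g-computable = 0 , 0 , skip , λ n → _ , _ , skip
  ; g-bound      = λ _ _ → ≤-refl
  ; extraSymbols = 1
  ; extraStacks  = 7
  ; program      = reduction
  -- The bound on the running time is independent of k, so any computable function without zeros
  -- serves.
  ; f            = suc
  ; f-computable = 0 , 0 , push zero zero , λ n → _ , _ , push
  ; c            = 2
  -- This is 283 + 478 + 229, valid once |I| is at least 1.
  ; const        = 990
  ; size₀        = 1
  ; computes     = λ I k →
      let rest , steps , steps≤ , run = runs-reduction I k in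
      steps , rest , run , λ 1≤∣I∣ → ≤-trans steps≤ (quadratic≤ 283 478 229 k (length I) 1≤∣I∣)
  }
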